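{- Let $(c_i)_{i\ge 1}$ be a sequence of integers, let $F(s)=\sum_{i\ge 0} c_i\,\frac{s^{i+1}}{i+1}$ with $c_0=1$, and let $G(t)$ be the compositional inverse of $F$ (so $F(G(t))=t$). Define polynomials $B_n^G(x)$ by $$\frac{t}{G(t)}e^{xt}=\sum_{n\ge 0} B_n^G(x)\frac{t^n}{n!},$$ put $B_n^G:=B_n^G(0)$ and $\widetilde{B}_n^G(x):=B_n^G(x)-B_n^G$. Assume that $c_{p-1}\equiv 0$ or $c_{p-1}\equiv 1 \pmod p$ for every odd prime $p$, and that either $c_1\equiv c_3 \pmod 2$, or $c_1$ is odd and $c_3$ is even. Then for all integers $h>0$, $k>0$, $n\ge 0$, $$k^n\,\widetilde{B}_n^G\!\left(\frac{h}{k}\right)\in\mathbb{Z}.$$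
   Context: $G(t)$ is called the formal group exponential associated with the formal group logarithm $F(s)$; the polynomials $B_n^G(x)$ are generalized (universal) Bernoulli polynomials associated with $G$. -}

module Defs where

open import Data.Nat as ℕ using (ℕ; zero; suc)
open import Data.Nat.Base using (_!)
open import Data.Nat.Properties using (_!≢0)
open import Data.Integer as ℤ using (ℤ; +_)
open import Data.Rational using (ℚ; 0ℚ; 1ℚ; _+_; _*_; _/_)
open import Relation.Binary.PropositionalEquality using (_≡_)
open import Data.Product using (_×_)

-- Formal power series over ℚ, represented by their coefficient sequences.
Series : Set
Series = ℕ → ℚ

Σ< : ℕ → (ℕ → ℚ) → ℚ
Σ< zero    f = 0ℚ
Σ< (suc n) f = Σ< n f + f n

Σ≤ : ℕ → (ℕ → ℚ) → ℚ
Σ≤ n f = Σ< (suc n) f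

_^ℚ_ : ℚ → ℕ → ℚ
x ^ℚ zero  = 1ℚ
x ^ℚ suc n = x * (x ^ℚ n)

ι : ℤ → ℚ
ι z = z / 1

inv! : ℕ → ℚ
inv! n = (+ 1) / (n !) where instance _ = n !≢0

oneS : Series
oneS zero    = 1ℚ
oneS (suc _) = 0ℚ

tS : Series
tS (suc zero) = 1ℚ
tS _          = 0ℚ

_⊛_ : Series → Series → Series
(f ⊛ g) n = Σ≤ n (λ k → f k * g (n ℕ.∸ k))

powS : Series → ℕ → Series
powS f zero    = oneS
powS f (suc m) = f ⊛ powS f m

-- composition f(g(t)), for g with zero constant term:
-- [t^n] f(g(t)) = Σ_{i≤n} f_i [t^n] g(t)^i
compS : Series → Series → Series
compS f g n = Σ≤ n (λ i → f i * powS g i n)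

expS : ℚ → Series
expS x n = (x ^ℚ n) * inv! n

FS : (ℕ → ℤ) → Series
FS c zero    = 0ℚ
FS c (suc i) = c i / suc i

divT : Series → Series
divT g n = g (suc n)

IsCompInverse : Series → Series → Set
IsCompInverse F g = (g 0 ≡ 0ℚ) × (∀ n → compS F g n ≡ tS n)


IsTOverG : Series → Series → Set
IsTOverG g T = ∀ n → (T ⊛ divT g) n ≡ oneS n

-- B_n^G(x) = n! [t^n] ( t/G(t) · e^{xt} ), where T = t/G(t)
BG : Series → ℕ → ℚ → ℚ
BG T n x = ι (+ (n !)) * (T ⊛ expS x) n

BGt : Series → ℕ → ℚ → ℚ
BGt T n x = BG T n x Data.Rational.- BG T n 0ℚ

{-# OPTIONS --safe #-}
module Submission where

-- Substituting t = F(s) turns t/G(t) into F(s)/s, so t/G(t) = Σ cᵢ i!/(i+1) · Gⁱ/i!.  Call a series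
-- Σ aₙ tⁿ/n! with integral aₙ a Hurwitz series; these form a ring, and all Gⁱ/i! belong to it.  The
-- claim says that t/G(t) at kt, times e^{ht} - 1, is Hurwitz, and this holds for each i separately:
-- i + 1 divides i! unless i + 1 is a prime p or 4, where only one factor p is missing (p = 2 for 4).
-- If p ∣ cᵢ or p ∣ k, that factor comes from cᵢ or kⁱ.  Otherwise h ≡ km mod p reduces e^{ht} - 1 to
-- a multiple of e^{kt} - 1, and composition with F leaves the claim that sⁱ/i! · (exp F(s) - 1)
-- vanishes mod p.  Writing exp F = Σ eₙ sⁿ/n!, this follows from p ∣ eₙ for n ≥ p, which the
-- recursion for eₙ reduces to p ∣ eₚ; and p ∣ eₚ holds when c_{p-1} ≡ 1, by comparison with
-- F = -log(1 - s).

-- The obstacle is composition: G has to be substituted without ever dividing by i!. Since c₀ = 1,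
-- the series q = 1/F′ is Hurwitz, and G′ = q(G); so by Taylor's formula the coefficients of φ(G(t))
-- are the values at 0 of (q d/ds)ⁿ φ. This rule stays within the integers, preserves divisibility,
-- and is multiplicative because q d/ds is a derivation; applied to φ = sⁱ/i! it yields the
-- integrality of Gⁱ/i!. The series exp F and 1/F′ are likewise solutions of integral differential
-- equations, and their properties follow from uniqueness of solutions. Rational series serve to
-- express the claim and to identify the given `g` and `T` with these integral models.

-- Hurwitz series: the ring and its binomial product formula.

module HurwitzSeries where

  open import Data.Nat as ℕ using (ℕ; zero; suc; _≤_; _<_; z≤n; s≤s; _∸_)
  import Data.Nat.Properties as ℕₚ
  open import Data.Nat.Combinatorics using (_C_; k>n⇒nCk≡0; nCk+nC[k+1]≡[n+1]C[k+1])
  open import Data.Integer using (ℤ; +_; _+_; _*_; -_; _-_; 0ℤ; 1ℤ)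
  open import Data.Integer.Properties
  open import Data.Integer.Divisibility.Signed using (_∣_; divides; ∣m∣n⇒∣m+n; ∣m⇒∣m*n)
  open import Data.Integer.Tactic.RingSolver using (solve-∀)
  open import Relation.Nullary using (yes; no)
  open import Relation.Binary.PropositionalEquality

  H : Set
  H = ℕ → ℤ

  D : H → H
  D a n = a (suc n)

  infixl 7 _⋆_ _⊙_
  infixl 6 _⊞_

  -- The Leibniz rule is taken as the definition: it gives the binomial convolution without binomial
  -- coefficients, and the ring laws become inductions on the degree.
  _⋆_ : H → H → H
  (a ⋆ b) zero    = a 0 * b 0
  (a ⋆ b) (suc n) = (D a ⋆ b) n + (a ⋆ D b) n

  _⊞_ : H → H → H
  (a ⊞ b) n = a n + b n

  _⊙_ : ℤ → H → H
  (x ⊙ a) n = x * a n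

  -- s^i / i!
  γ : ℕ → H
  γ zero    zero    = 1ℤ
  γ zero    (suc _) = 0ℤ
  γ (suc i) zero    = 0ℤ
  γ (suc i) (suc n) = γ i n

  AgreeTo : ℕ → H → H → Set
  AgreeTo n a b = ∀ j → j ≤ n → a j ≡ b j

  D-agree : ∀ {n a b} → AgreeTo (suc n) a b → AgreeTo n (D a) (D b)
  D-agree e j j≤n = e (suc j) (s≤s j≤n)

  agree-≤ : ∀ {n a b} → AgreeTo (suc n) a b → AgreeTo n a b
  agree-≤ e j j≤n = e j (ℕₚ.m≤n⇒m≤1+n j≤n)

  ⋆-local : ∀ n {a a′ b b′} → AgreeTo n a a′ → AgreeTo n b b′ → (a ⋆ b) n ≡ (a′ ⋆ b′) n
  ⋆-local zero    e f = cong₂ _*_ (e 0 z≤n) (f 0 z≤n)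
  ⋆-local (suc n) e f =
    cong₂ _+_ (⋆-local n (D-agree e) (agree-≤ f)) (⋆-local n (agree-≤ e) (D-agree f))

  ⋆-cong : ∀ {a a′ b b′} → a ≗ a′ → b ≗ b′ → a ⋆ b ≗ a′ ⋆ b′
  ⋆-cong e f n = ⋆-local n (λ j _ → e j) (λ j _ → f j)

  ⋆-congˡ : ∀ a {b b′} → b ≗ b′ → a ⋆ b ≗ a ⋆ b′
  ⋆-congˡ a = ⋆-cong {a} (λ _ → refl)

  ⋆-congʳ : ∀ {a a′} b → a ≗ a′ → a ⋆ b ≗ a′ ⋆ b
  ⋆-congʳ b e = ⋆-cong {b = b} e (λ _ → refl)

  ⋆-comm : ∀ a b → a ⋆ b ≗ b ⋆ a
  ⋆-comm a b zero    = *-comm (a 0) (b 0)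
  ⋆-comm a b (suc n) = trans (cong₂ _+_ (⋆-comm (D a) b n) (⋆-comm a (D b) n))
                             (+-comm ((b ⋆ D a) n) ((D b ⋆ a) n))

  interchange : ∀ x y z w → (x + y) + (z + w) ≡ (x + z) + (y + w)
  interchange = solve-∀

  ⋆-distribʳ : ∀ a b d → (a ⊞ b) ⋆ d ≗ (a ⋆ d) ⊞ (b ⋆ d)
  ⋆-distribʳ a b d zero    = *-distribʳ-+ (d 0) (a 0) (b 0)
  ⋆-distribʳ a b d (suc n) =
    trans (cong₂ _+_ (⋆-distribʳ (D a) (D b) d n) (⋆-distribʳ a b (D d) n))
          (interchange ((D a ⋆ d) n) ((D b ⋆ d) n) ((a ⋆ D d) n) ((b ⋆ D d) n))

  ⋆-distribˡ : ∀ d a b → d ⋆ (a ⊞ b) ≗ (d ⋆ a) ⊞ (d ⋆ b)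
  ⋆-distribˡ d a b n = trans (⋆-comm d (a ⊞ b) n)
    (trans (⋆-distribʳ a b d n) (cong₂ _+_ (⋆-comm a d n) (⋆-comm b d n)))

  ⋆-scaleʳ : ∀ x a b → (x ⊙ a) ⋆ b ≗ x ⊙ (a ⋆ b)
  ⋆-scaleʳ x a b zero    = *-assoc x (a 0) (b 0)
  ⋆-scaleʳ x a b (suc n) = trans (cong₂ _+_ (⋆-scaleʳ x (D a) b n) (⋆-scaleʳ x a (D b) n))
                                 (sym (*-distribˡ-+ x ((D a ⋆ b) n) ((a ⋆ D b) n)))

  ⋆-scaleˡ : ∀ x a b → a ⋆ (x ⊙ b) ≗ x ⊙ (a ⋆ b)
  ⋆-scaleˡ x a b n = trans (⋆-comm a (x ⊙ b) n)
    (trans (⋆-scaleʳ x b a n) (cong (x *_) (⋆-comm b a n)))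

  ⋆-assoc : ∀ a b d → (a ⋆ b) ⋆ d ≗ a ⋆ (b ⋆ d)
  ⋆-assoc a b d zero    = *-assoc (a 0) (b 0) (d 0)
  ⋆-assoc a b d (suc n) = begin
    ((D a ⋆ b ⊞ a ⋆ D b) ⋆ d) n + ((a ⋆ b) ⋆ D d) n
      ≡⟨ cong (_+ ((a ⋆ b) ⋆ D d) n) (⋆-distribʳ (D a ⋆ b) (a ⋆ D b) d n) ⟩
    (((D a ⋆ b) ⋆ d) n + ((a ⋆ D b) ⋆ d) n) + ((a ⋆ b) ⋆ D d) n
      ≡⟨ cong₂ _+_ (cong₂ _+_ (⋆-assoc (D a) b d n) (⋆-assoc a (D b) d n)) (⋆-assoc a b (D d) n) ⟩
    ((D a ⋆ (b ⋆ d)) n + (a ⋆ (D b ⋆ d)) n) + (a ⋆ (b ⋆ D d)) n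
      ≡⟨ +-assoc ((D a ⋆ (b ⋆ d)) n) ((a ⋆ (D b ⋆ d)) n) ((a ⋆ (b ⋆ D d)) n) ⟩
    (D a ⋆ (b ⋆ d)) n + ((a ⋆ (D b ⋆ d)) n + (a ⋆ (b ⋆ D d)) n)
      ≡⟨ cong (λ x → (D a ⋆ (b ⋆ d)) n + x) (⋆-distribˡ a (D b ⋆ d) (b ⋆ D d) n) ⟨
    (D a ⋆ (b ⋆ d)) n + (a ⋆ D (b ⋆ d)) n ∎
    where open ≡-Reasoning

  ⋆-swapˡ : ∀ a b d → a ⋆ (b ⋆ d) ≗ b ⋆ (a ⋆ d)
  ⋆-swapˡ a b d n = trans (sym (⋆-assoc a b d n)) (trans (⋆-congʳ d (⋆-comm a b) n) (⋆-assoc b a d n))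

  ⋆-zeroˡ : ∀ {a} b n → (∀ j → j ≤ n → a j ≡ 0ℤ) → (a ⋆ b) n ≡ 0ℤ
  ⋆-zeroˡ b zero    e rewrite e 0 z≤n = *-zeroˡ (b 0)
  ⋆-zeroˡ b (suc n) e
    rewrite ⋆-zeroˡ b n (λ j l → e (suc j) (s≤s l))
          | ⋆-zeroˡ (D b) n (λ j l → e j (ℕₚ.m≤n⇒m≤1+n l)) = refl

  ⋆-identityˡ : ∀ a → γ 0 ⋆ a ≗ a
  ⋆-identityˡ a zero    = *-identityˡ (a 0)
  ⋆-identityˡ a (suc n) =
    trans (cong₂ _+_ (⋆-zeroˡ a n (λ _ _ → refl)) (⋆-identityˡ (D a) n)) (+-identityˡ (a (suc n)))

  ⋆-∣ : ∀ {d a} b → (∀ n → d ∣ a n) → ∀ n → d ∣ (a ⋆ b) n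
  ⋆-∣ b e zero    = ∣m⇒∣m*n (b 0) (e 0)
  ⋆-∣ b e (suc n) = ∣m∣n⇒∣m+n (⋆-∣ b (λ j → e (suc j)) n) (⋆-∣ (D b) e n)

  ⋆-∣ʳ : ∀ {d b} a → (∀ n → d ∣ b n) → ∀ n → d ∣ (a ⋆ b) n
  ⋆-∣ʳ {d} {b} a e n = subst (d ∣_) (⋆-comm b a n) (⋆-∣ a e n)

  sumℤ : ℕ → H → ℤ
  sumℤ zero    f = 0ℤ
  sumℤ (suc n) f = sumℤ n f + f n

  sumℤ-cong : ∀ n {f g} → (∀ i → i < n → f i ≡ g i) → sumℤ n f ≡ sumℤ n g
  sumℤ-cong zero    e = refl
  sumℤ-cong (suc n) e =
    cong₂ _+_ (sumℤ-cong n (λ i l → e i (ℕₚ.m≤n⇒m≤1+n l))) (e n ℕₚ.≤-refl)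

  sumℤ-∣ : ∀ {d} n {f} → (∀ i → i < n → d ∣ f i) → d ∣ sumℤ n f
  sumℤ-∣ zero    e = divides 0ℤ refl
  sumℤ-∣ (suc n) e = ∣m∣n⇒∣m+n (sumℤ-∣ n (λ i l → e i (ℕₚ.m≤n⇒m≤1+n l))) (e n ℕₚ.≤-refl)

  sumℤ-const : ∀ n x → sumℤ n (λ _ → x) ≡ + n * x
  sumℤ-const zero    x = sym (*-zeroˡ x)
  sumℤ-const (suc n) x = trans (cong (_+ x) (sumℤ-const n x)) (lem (+ n) x)
    where
    lem : ∀ m x → m * x + x ≡ (1ℤ + m) * x
    lem = solve-∀

  γ-diag : ∀ n → γ n n ≡ 1ℤ
  γ-diag zero    = refl
  γ-diag (suc n) = γ-diag n

  γ-< : ∀ {i n} → n < i → γ i n ≡ 0ℤ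
  γ-< {suc i} {zero}  _       = refl
  γ-< {suc i} {suc n} (s≤s l) = γ-< l

  γ-> : ∀ {i n} → i < n → γ i n ≡ 0ℤ
  γ-> {zero}  {suc n} _       = refl
  γ-> {suc i} {suc n} (s≤s l) = γ-> l

  γ-⋆ : ∀ i b n → (γ i ⋆ b) n ≡ + (n C i) * b (n ∸ i)
  γ-⋆ zero    b zero    = refl
  γ-⋆ zero    b (suc n) = trans (⋆-identityˡ b (suc n)) (sym (*-identityˡ (b (suc n))))
  γ-⋆ (suc i) b zero    = trans (*-zeroˡ (b 0)) (sym (*-zeroˡ (b 0)))
  γ-⋆ (suc i) b (suc n) = begin
    (γ i ⋆ b) n + (γ (suc i) ⋆ D b) n                ≡⟨ cong₂ _+_ (γ-⋆ i b n) (γ-⋆ (suc i) (D b) n) ⟩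
    + (n C i) * b (n ∸ i) + + (n C suc i) * b (suc (n ∸ suc i)) ≡⟨ cong (λ x → + (n C i) * b (n ∸ i) + x) shift ⟩
    + (n C i) * b (n ∸ i) + + (n C suc i) * b (n ∸ i) ≡⟨ *-distribʳ-+ (b (n ∸ i)) (+ (n C i)) (+ (n C suc i)) ⟨
    + (n C i ℕ.+ n C suc i) * b (n ∸ i)               ≡⟨ cong (λ x → + x * b (n ∸ i)) (nCk+nC[k+1]≡[n+1]C[k+1] n i) ⟩
    + (suc n C suc i) * b (n ∸ i)                     ∎
    where
    open ≡-Reasoning
    shift : + (n C suc i) * b (suc (n ∸ suc i)) ≡ + (n C suc i) * b (n ∸ i)
    shift with suc i ℕ.≤? n
    ... | yes i<n = cong (λ m → + (n C suc i) * b m) (sym (ℕₚ.+-∸-assoc 1 i<n))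
    ... | no  i≮n rewrite k>n⇒nCk≡0 {n} {suc i} (ℕₚ.≰⇒> i≮n) =
      trans (*-zeroˡ (b (suc (n ∸ suc i)))) (sym (*-zeroˡ (b (n ∸ i))))

  partialSum : H → ℕ → H
  partialSum a N j = sumℤ N (λ i → a i * γ i j)

  partialSum-≥ : ∀ a N {j} → N ≤ j → partialSum a N j ≡ 0ℤ
  partialSum-≥ a zero    l = refl
  partialSum-≥ a (suc N) {j} l
    rewrite partialSum-≥ a N {j} (ℕₚ.<⇒≤ l) | γ-> {N} {j} l = trans (+-identityˡ _) (*-zeroʳ (a N))

  partialSum-< : ∀ a N {j} → j < N → partialSum a N j ≡ a j
  partialSum-< a (suc N) {j} (s≤s l) with j ℕ.≟ N
  ... | yes refl rewrite partialSum-≥ a N {N} ℕₚ.≤-refl | γ-diag N =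
        trans (+-identityˡ _) (*-identityʳ (a N))
  ... | no  j≢N  rewrite partialSum-< a N (ℕₚ.≤∧≢⇒< l j≢N) | γ-< {N} {j} (ℕₚ.≤∧≢⇒< l j≢N) =
        trans (cong (λ x → a j + x) (*-zeroʳ (a N))) (+-identityʳ (a j))

  partialSum-⋆ : ∀ a b N → partialSum a N ⋆ b ≗ λ n → sumℤ N (λ i → a i * (γ i ⋆ b) n)
  partialSum-⋆ a b zero    n = ⋆-zeroˡ b n (λ _ _ → refl)
  partialSum-⋆ a b (suc N) n =
    trans (⋆-distribʳ (partialSum a N) (a N ⊙ γ N) b n)
          (cong₂ _+_ (partialSum-⋆ a b N n) (⋆-scaleʳ (a N) (γ N) b n))

  -- The left factor may be cut to a finite sum of multiples of the `γ i`, which changes nothing up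
  -- to degree n; multiplication by `γ i` is a shift with a binomial coefficient.
  ⋆-expand : ∀ a b n → (a ⋆ b) n ≡ sumℤ (suc n) (λ i → a i * (+ (n C i) * b (n ∸ i)))
  ⋆-expand a b n = begin
    (a ⋆ b) n                                    ≡⟨ ⋆-local n (λ j l → partialSum-< a (suc n) (s≤s l)) (λ _ _ → refl) ⟨
    (partialSum a (suc n) ⋆ b) n                 ≡⟨ partialSum-⋆ a b (suc n) n ⟩
    sumℤ (suc n) (λ i → a i * (γ i ⋆ b) n)       ≡⟨ sumℤ-cong (suc n) (λ i _ → cong (a i *_) (γ-⋆ i b n)) ⟩
    sumℤ (suc n) (λ i → a i * (+ (n C i) * b (n ∸ i))) ∎
    where open ≡-Reasoning

  -- Formal differential equations; exponential and reciprocal.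

  -- Causality: with it, the equation a′ = S a determines each coefficient of a from the earlier
  -- ones.
  Local : (H → H) → Set
  Local S = ∀ n {a b} → AgreeTo n a b → S a n ≡ S b n

  module ODE (x : ℤ) (S : H → H) (S-local : Local S) where

    -- The recursion a (n + 1) = S a n hands all of a to S and is not structural. The first argument
    -- is fuel; coefficient m is final as soon as the fuel is at least m.
    approx : ℕ → H
    approx zero    _       = x
    approx (suc N) zero    = x
    approx (suc N) (suc m) = S (approx N) m

    approx-stable : ∀ {N M} m → m ≤ N → m ≤ M → approx N m ≡ approx M m
    approx-stable {zero}  {zero}  zero    _       _        = refl
    approx-stable {zero}  {suc _} zero    _       _        = refl
    approx-stable {suc _} {zero}  zero    _       _        = refl
    approx-stable {suc _} {suc _} zero    _       _        = refl
    approx-stable {suc N} {suc M} (suc m) (s≤s l) (s≤s l′) =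
      S-local m (λ j j≤m → approx-stable j (ℕₚ.≤-trans j≤m l) (ℕₚ.≤-trans j≤m l′))

    solution : H
    solution n = approx n n

    solution-D : D solution ≗ S solution
    solution-D m = S-local m (λ j j≤m → approx-stable j j≤m ℕₚ.≤-refl)

    agree : ∀ {a b} → a 0 ≡ b 0 → D a ≗ S a → D b ≗ S b → ∀ n → AgreeTo n a b
    agree e₀ ea eb n       zero    _       = e₀
    agree e₀ ea eb (suc n) (suc j) (s≤s l) =
      trans (ea j) (trans (S-local j (λ i i≤j → agree e₀ ea eb n i (ℕₚ.≤-trans i≤j l))) (sym (eb j)))

    unique : ∀ {a b} → a 0 ≡ b 0 → D a ≗ S a → D b ≗ S b → a ≗ b
    unique e₀ ea eb n = agree e₀ ea eb n n ℕₚ.≤-refl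

  ⋆-localˡ : ∀ a → Local (a ⋆_)
  ⋆-localˡ a n e = ⋆-local n {a} (λ _ _ → refl) e

  module Exp (f : H) = ODE 1ℤ (f ⋆_) (⋆-localˡ f)

  -- The exponential of the antiderivative of f without constant term: f is the logarithmic
  -- derivative, not the exponent.
  expH : H → H
  expH f = Exp.solution f

  expH-D : ∀ f → D (expH f) ≗ f ⋆ expH f
  expH-D = Exp.solution-D

  expH-unique : ∀ f {a} → a 0 ≡ 1ℤ → D a ≗ f ⋆ a → a ≗ expH f
  expH-unique f e₀ e = Exp.unique f e₀ e (expH-D f)

  expH-cong : ∀ {f g} → f ≗ g → expH f ≗ expH g
  expH-cong {f} {g} e = expH-unique g refl (λ n → trans (expH-D f n) (⋆-congʳ (expH f) e n))

  expH-⊞ : ∀ f g → expH (f ⊞ g) ≗ expH f ⋆ expH g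
  expH-⊞ f g n = sym (expH-unique (f ⊞ g) refl deriv n)
    where
    open ≡-Reasoning
    deriv : D (expH f ⋆ expH g) ≗ (f ⊞ g) ⋆ (expH f ⋆ expH g)
    deriv m = begin
      (D (expH f) ⋆ expH g) m + (expH f ⋆ D (expH g)) m
        ≡⟨ cong₂ _+_ (⋆-congʳ (expH g) (expH-D f) m) (⋆-congˡ (expH f) (expH-D g) m) ⟩
      ((f ⋆ expH f) ⋆ expH g) m + (expH f ⋆ (g ⋆ expH g)) m
        ≡⟨ cong₂ _+_ (⋆-assoc f (expH f) (expH g) m) (⋆-swapˡ (expH f) g (expH g) m) ⟩
      (f ⋆ (expH f ⋆ expH g)) m + (g ⋆ (expH f ⋆ expH g)) m
        ≡⟨ ⋆-distribʳ f g (expH f ⋆ expH g) m ⟨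
      ((f ⊞ g) ⋆ (expH f ⋆ expH g)) m ∎

  -- From (1/f)′ = -(1/f)² f′.
  invStep : H → H → H
  invStep f q n = - ((q ⋆ (q ⋆ D f)) n)

  invStep-local : ∀ f → Local (invStep f)
  invStep-local f n e =
    cong -_ (⋆-local n e (λ j l → ⋆-local j (λ i i≤j → e i (ℕₚ.≤-trans i≤j l)) (λ _ _ → refl)))

  module Inv (f : H) = ODE 1ℤ (invStep f) (invStep-local f)

  invH : H → H
  invH f = Inv.solution f

  -- r = f · invH f satisfies r′ = v - v r with v = invH f · f′, and so does the constant 1.
  invH-inverse : ∀ f → f 0 ≡ 1ℤ → f ⋆ invH f ≗ γ 0
  invH-inverse f f₀ = Eq.unique (cong (_* 1ℤ) f₀) deriv-r deriv-1
    where
    open ≡-Reasoning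
    q v : H
    q = invH f
    v = q ⋆ D f
    step : H → H
    step a n = v n - (v ⋆ a) n
    module Eq = ODE 1ℤ step (λ n e → cong (λ x → v n - x) (⋆-localˡ v n e))
    deriv-1 : D (γ 0) ≗ step (γ 0)
    deriv-1 n = sym (trans (cong (λ x → v n - x) (trans (⋆-comm v (γ 0) n) (⋆-identityˡ v n)))
                           (+-inverseʳ (v n)))
    ⋆-neg : ∀ a b n → (a ⋆ (λ m → - b m)) n ≡ - ((a ⋆ b) n)
    ⋆-neg a b n = begin
      (a ⋆ (λ m → - b m)) n  ≡⟨ ⋆-congˡ a (λ m → sym (-1*i≡-i (b m))) n ⟩
      (a ⋆ ((- 1ℤ) ⊙ b)) n   ≡⟨ ⋆-scaleˡ (- 1ℤ) a b n ⟩
      - 1ℤ * (a ⋆ b) n       ≡⟨ -1*i≡-i ((a ⋆ b) n) ⟩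
      - ((a ⋆ b) n)          ∎
    deriv-r : D (f ⋆ q) ≗ step (f ⋆ q)
    deriv-r n = cong₂ _+_ (⋆-comm (D f) q n) (begin
      (f ⋆ D q) n                        ≡⟨ ⋆-congˡ f (Inv.solution-D f) n ⟩
      (f ⋆ (λ m → - ((q ⋆ v) m))) n      ≡⟨ ⋆-neg f (q ⋆ v) n ⟩
      - ((f ⋆ (q ⋆ v)) n)                ≡⟨ cong -_ (sym (⋆-assoc f q v n)) ⟩
      - (((f ⋆ q) ⋆ v) n)                ≡⟨ cong -_ (⋆-comm (f ⋆ q) v n) ⟩
      - ((v ⋆ (f ⋆ q)) n)                ∎)

  -- Substitution of a compositional inverse.

  -- Composition with the G for which G′ = q(G): by Taylor's formula, the n-th coefficient
  -- of φ(G(t)) is the value at 0 of (q d/ds)ⁿ φ.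
  Φ : H → H → H
  Φ q φ zero    = φ 0
  Φ q φ (suc n) = Φ q (q ⋆ D φ) n

  Φ-cong : ∀ q {φ ψ} → φ ≗ ψ → Φ q φ ≗ Φ q ψ
  Φ-cong q e zero    = e 0
  Φ-cong q e (suc n) = Φ-cong q (⋆-congˡ q (λ j → e (suc j))) n

  Φ-⊞ : ∀ q φ ψ → Φ q (φ ⊞ ψ) ≗ Φ q φ ⊞ Φ q ψ
  Φ-⊞ q φ ψ zero    = refl
  Φ-⊞ q φ ψ (suc n) = trans (Φ-cong q (⋆-distribˡ q (D φ) (D ψ)) n) (Φ-⊞ q (q ⋆ D φ) (q ⋆ D ψ) n)

  Φ-⊙ : ∀ q x φ → Φ q (x ⊙ φ) ≗ x ⊙ Φ q φ
  Φ-⊙ q x φ zero    = refl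
  Φ-⊙ q x φ (suc n) = trans (Φ-cong q (⋆-scaleˡ x q (D φ)) n) (Φ-⊙ q x (q ⋆ D φ) n)

  -- As q d/ds is a derivation, the induction reproduces the Leibniz recursion that defines `⋆`.
  Φ-⋆ : ∀ q φ ψ → Φ q (φ ⋆ ψ) ≗ Φ q φ ⋆ Φ q ψ
  Φ-⋆ q φ ψ zero    = refl
  Φ-⋆ q φ ψ (suc n) = begin
    Φ q (q ⋆ (D φ ⋆ ψ ⊞ φ ⋆ D ψ)) n
      ≡⟨ Φ-cong q (λ m → trans (⋆-distribˡ q (D φ ⋆ ψ) (φ ⋆ D ψ) m)
           (cong₂ _+_ (sym (⋆-assoc q (D φ) ψ m)) (⋆-swapˡ q φ (D ψ) m))) n ⟩
    Φ q ((q ⋆ D φ) ⋆ ψ ⊞ φ ⋆ (q ⋆ D ψ)) n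
      ≡⟨ Φ-⊞ q ((q ⋆ D φ) ⋆ ψ) (φ ⋆ (q ⋆ D ψ)) n ⟩
    Φ q ((q ⋆ D φ) ⋆ ψ) n + Φ q (φ ⋆ (q ⋆ D ψ)) n
      ≡⟨ cong₂ _+_ (Φ-⋆ q (q ⋆ D φ) ψ n) (Φ-⋆ q φ (q ⋆ D ψ) n) ⟩
    (Φ q φ ⋆ Φ q ψ) (suc n) ∎
    where open ≡-Reasoning

  Φ-∣ : ∀ {d} q {φ} → (∀ n → d ∣ φ n) → ∀ n → d ∣ Φ q φ n
  Φ-∣ q e zero    = e 0
  Φ-∣ q e (suc n) = Φ-∣ q (⋆-∣ʳ q (λ j → e (suc j))) n

  Φ-1 : ∀ q → Φ q (γ 0) ≗ γ 0
  Φ-1 q zero    = refl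
  Φ-1 q (suc n) = trans (Φ-cong q {ψ = 0ℤ ⊙ γ 0} (λ m → trans (⋆-comm q (D (γ 0)) m)
                     (trans (⋆-zeroˡ q m (λ _ _ → refl)) (sym (*-zeroˡ (γ 0 m))))) n)
                   (trans (Φ-⊙ q 0ℤ (γ 0) n) (*-zeroˡ (Φ q (γ 0) n)))

  Φ-local : ∀ q n {φ ψ} → AgreeTo n φ ψ → Φ q φ n ≡ Φ q ψ n
  Φ-local q zero    e = e 0 z≤n
  Φ-local q (suc n) e = Φ-local q n (λ j l → ⋆-localˡ q j (λ i i≤j → e (suc i) (s≤s (ℕₚ.≤-trans i≤j l))))

-- Factorials and binomial coefficients modulo primes.

module FactorialDivisibility where

  open import Data.Nat
  open import Data.Nat.Properties
  open import Data.Nat.Combinatorics using (_C_; k![n∸k]!∣n!; nCk≡n!/k![n-k]!)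
  open import Data.Nat.Divisibility
  open import Data.Nat.DivMod using (m/n*n≡m)
  open import Data.Nat.Primality
  open import Data.Nat.Coprimality using (Coprime)
  open import Data.Product using (_,_)
  open import Data.Sum using (inj₁; inj₂; [_,_]′)
  open import Relation.Nullary using (¬_; contradiction)
  open import Relation.Binary.Definitions using (tri<; tri≈; tri>)
  open import Relation.Binary.PropositionalEquality

  nCk*[k!*[n∸k]!]≡n! : ∀ {n k} → k ≤ n → (n C k) * (k ! * (n ∸ k) !) ≡ n !
  nCk*[k!*[n∸k]!]≡n! {n} {k} k≤n =
    trans (cong (_* (k ! * (n ∸ k) !)) (nCk≡n!/k![n-k]! k≤n)) (m/n*n≡m (k![n∸k]!∣n! k≤n))
    where instance _ = k !* (n ∸ k) !≢0

  prime⇒>1 : ∀ {p} → Prime p → 1 < p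
  prime⇒>1 pr = nonTrivial⇒n>1 _ {{prime⇒nonTrivial pr}}

  m≤n⇒m∣n! : ∀ {m n} → 1 ≤ m → m ≤ n → m ∣ n !
  m≤n⇒m∣n! {suc m} _ m≤n = ∣-trans (m∣m*n (m !)) (m≤n⇒m!∣n! m≤n)

  prime∤! : ∀ {p} → Prime p → ∀ j → j < p → ¬ p ∣ j !
  prime∤! pr zero    _   p∣1 = >⇒∤ (prime⇒>1 pr) p∣1
  prime∤! pr (suc j) j<p p∣  = [ >⇒∤ j<p , prime∤! pr j (<-trans (n<1+n j) j<p) ]′ (euclidsLemma (suc j) (j !) pr p∣)

  -- The product is n!/(n - j)!; p divides the numerator and not the denominator.
  prime∣C*! : ∀ {p n j} → Prime p → j ≤ n → p ≤ n → n ∸ j < p → p ∣ (n C j) * j !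
  prime∣C*! {p} {n} {j} pr j≤n p≤n n∸j<p
    with euclidsLemma ((n C j) * j !) ((n ∸ j) !) pr
           (subst (p ∣_) (sym (trans (*-assoc (n C j) (j !) ((n ∸ j) !)) (nCk*[k!*[n∸k]!]≡n! j≤n)))
                  (m≤n⇒m∣n! (<⇒≤ (prime⇒>1 pr)) p≤n))
  ... | inj₁ p∣ = p∣
  ... | inj₂ p∣ = contradiction p∣ (prime∤! pr (n ∸ j) n∸j<p)

  prime∣C : ∀ {p n j} → Prime p → j ≤ n → p ≤ n → n ∸ j < p → j < p → p ∣ (n C j)
  prime∣C {p} {n} {j} pr j≤n p≤n n∸j<p j<p
    with euclidsLemma (n C j) (j !) pr (prime∣C*! pr j≤n p≤n n∸j<p)
  ... | inj₁ p∣ = p∣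
  ... | inj₂ p∣ = contradiction p∣ (prime∤! pr j j<p)

  a*b∣n! : ∀ {a b n} → 1 ≤ a → a < b → b ≤ n → a * b ∣ n !
  a*b∣n! {a} {suc b} {n} 1≤a (s≤s a≤b) b≤n =
    ∣-trans (subst (_∣ suc b * b !) (*-comm (suc b) a) (*-monoʳ-∣ (suc b) (m≤n⇒m∣n! 1≤a a≤b)))
            (m≤n⇒m!∣n! b≤n)

  -- Two different proper factors with product n + 1 both occur in n!. If n + 1 = a² with a > 2, the
  -- numbers a and 2a occur instead, since 2a < a²; only 2 · 2 escapes.
  composite∣! : ∀ n → Composite (suc n) → suc n ≢ 4 → suc n ∣ n !
  composite∣! n (composite {b} b<n (divides a eq)) n≢4 = help
    where
    1<b : 1 < b
    1<b = nonTrivial⇒n>1 b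
    cofactor>1 : ∀ x → suc n ≡ x * b → 1 < x
    cofactor>1 zero          ()
    cofactor>1 (suc zero)    e = contradiction (trans e (*-identityˡ b)) (>⇒≢ b<n)
    cofactor>1 (suc (suc _)) _ = s≤s (s≤s z≤n)
    1<a : 1 < a
    1<a = cofactor>1 a eq
    instance
      _ = >-nonZero (<-trans (s≤s z≤n) 1<b)
      _ = >-nonZero (<-trans (s≤s z≤n) 1<a)
    a<n : a < suc n
    a<n = subst (a <_) (sym eq) (m<m*n a b 1<b)
    square : ∀ a → suc n ≡ a * a → 1 < a → suc n ∣ n !
    square (suc zero) _ (s≤s ())
    square (suc (suc zero)) e _ = contradiction e n≢4
    square (suc (suc (suc m))) e _ =
      ∣-trans (subst (_∣ x * (2 * x)) (sym e) (*-monoʳ-∣ x (n∣m*n 2 {x})))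
              (a*b∣n! {x} {2 * x} (s≤s z≤n) (m<m+n x (s≤s z≤n)) (≤-pred (subst (2 * x <_) (sym e) 2x<xx)))
      where
      x = suc (suc (suc m))
      2x<xx : 2 * x < x * x
      2x<xx = *-monoˡ-< x {x = 2} {y = x} (s≤s (s≤s (s≤s z≤n)))
    help : suc n ∣ n !
    help with <-cmp a b
    ... | tri< a<b _ _ = subst (_∣ n !) (sym eq) (a*b∣n! (<⇒≤ 1<a) a<b (≤-pred b<n))
    ... | tri> _ _ b<a = subst (_∣ n !) (trans (*-comm b a) (sym eq)) (a*b∣n! (<⇒≤ 1<b) b<a (≤-pred a<n))
    ... | tri≈ _ a≡b _ = square a (subst (λ y → suc n ≡ a * y) (sym a≡b) eq) 1<a

  prime∤⇒coprime : ∀ {p k} → Prime p → ¬ p ∣ k → Coprime k p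
  prime∤⇒coprime pr p∤k (d∣k , d∣p) with prime⇒irreducible pr d∣p
  ... | inj₁ d≡1  = d≡1
  ... | inj₂ refl = contradiction d∣k p∤k

-- Divisibility of the coefficients of exp F.

module TermwiseDivisibility where

  open HurwitzSeries
  open FactorialDivisibility
  open import Data.Nat as ℕ using (ℕ; zero; suc; _≤_; _<_; z≤n; s≤s; _∸_; _!)
  import Data.Nat.Properties as ℕₚ
  import Data.Nat.Divisibility as ℕᵈ
  open import Data.Nat.Induction using (<-rec)
  open import Data.Nat.Combinatorics using (_C_; k>n⇒nCk≡0; nC1≡n)
  open import Data.Nat.Primality using (Prime; prime?; ¬prime⇒composite; prime⇒irreducible; prime[2])
  open import Data.Nat.Coprimality using (coprime-Bézout)
  open import Data.Nat.GCD using (module Bézout)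
  open import Data.Integer using (ℤ; +_; _+_; _*_; -_; _-_; _^_; 0ℤ; 1ℤ)
  open import Data.Integer.Properties
  open import Data.Integer.Divisibility.Signed
  open import Data.Integer.Tactic.RingSolver using (solve-∀)
  open import Data.Product using (∃; _,_)
  open import Data.Sum using (_⊎_; inj₁; inj₂)
  open import Relation.Nullary using (¬_; yes; no; contradiction)
  open import Relation.Binary.Definitions using (tri<; tri≈; tri>)
  open import Relation.Binary.PropositionalEquality

  ∣0 : ∀ {d} → d ∣ 0ℤ
  ∣0 = divides 0ℤ refl

  1∣ : ∀ x → 1ℤ ∣ x
  1∣ x = divides x (sym (*-identityʳ x))

  ∣⁺ : ∀ {m n} → m ℕᵈ.∣ n → + m ∣ + n
  ∣⁺ = ∣ᵤ⇒∣

  fac : H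
  fac n = + (n !)

  -- The series `fac` is 1/(1 - s), whose derivative is its square: all m + 1 terms of the
  -- convolution in degree m equal m!.
  expH-fac : expH fac ≗ fac
  expH-fac n = sym (expH-unique fac refl deriv n)
    where
    open ≡-Reasoning
    rearrange : ∀ x y z → x * (y * z) ≡ y * (x * z)
    rearrange = solve-∀
    term : ∀ m i → i < suc m → fac i * (+ (m C i) * fac (m ∸ i)) ≡ fac m
    term m i (s≤s i≤m) = begin
      fac i * (+ (m C i) * fac (m ∸ i))  ≡⟨ rearrange (fac i) (+ (m C i)) (fac (m ∸ i)) ⟩
      + (m C i) * (fac i * fac (m ∸ i))  ≡⟨ cong (+ (m C i) *_) (pos-* (i !) ((m ∸ i) !)) ⟨
      + (m C i) * + (i ! ℕ.* (m ∸ i) !)  ≡⟨ pos-* (m C i) (i ! ℕ.* (m ∸ i) !) ⟨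
      + ((m C i) ℕ.* (i ! ℕ.* (m ∸ i) !)) ≡⟨ cong +_ (nCk*[k!*[n∸k]!]≡n! i≤m) ⟩
      fac m                              ∎
    deriv : D fac ≗ fac ⋆ fac
    deriv m = begin
      + (suc m !)                     ≡⟨ pos-* (suc m) (m !) ⟩
      + suc m * fac m                 ≡⟨ sumℤ-const (suc m) (fac m) ⟨
      sumℤ (suc m) (λ _ → fac m)      ≡⟨ sumℤ-cong (suc m) (term m) ⟨
      sumℤ (suc m) (λ i → fac i * (+ (m C i) * fac (m ∸ i))) ≡⟨ ⋆-expand fac fac m ⟨
      (fac ⋆ fac) m                   ∎

  -- In degree p the inner binomial coefficients vanish mod p, so only the two outermost terms
  -- matter.
  prime∣⋆ : ∀ {p} → Prime p → ∀ a b → + p ∣ a p → + p ∣ b p → + p ∣ (a ⋆ b) p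
  prime∣⋆ {p} pr a b p∣a p∣b = subst (+ p ∣_) (sym (⋆-expand a b p)) (sumℤ-∣ (suc p) term)
    where
    term : ∀ i → i < suc p → + p ∣ a i * (+ (p C i) * b (p ∸ i))
    term zero    _ = ∣n⇒∣m*n (a 0) (∣n⇒∣m*n (+ (p C 0)) p∣b)
    term (suc i) (s≤s i<p) with suc i ℕ.≟ p
    ... | yes refl = ∣m⇒∣m*n _ p∣a
    ... | no  i≢p  = ∣n⇒∣m*n (a (suc i)) (∣m⇒∣m*n (b (p ∸ suc i)) (∣⁺
          (prime∣C pr i<p ℕₚ.≤-refl (ℕₚ.∸-monoʳ-< (s≤s z≤n) i<p) (ℕₚ.≤∧≢⇒< i<p i≢p))))

  -- This exponential is exp(x sʳ⁺¹/(r+1)!), a series in sʳ⁺¹; its recursion moves in steps of r +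
  -- 1.
  expH-γ : ∀ x r n → ¬ suc r ℕᵈ.∣ n → expH (x ⊙ γ r) n ≡ 0ℤ
  expH-γ x r = <-rec _ step
    where
    E = expH (x ⊙ γ r)
    step : ∀ n → (∀ {m} → m < n → ¬ suc r ℕᵈ.∣ m → E m ≡ 0ℤ) → ¬ suc r ℕᵈ.∣ n → E n ≡ 0ℤ
    step zero    rec r∤ = contradiction (suc r ℕᵈ.∣0) r∤
    step (suc n) rec r∤ = trans (expH-D (x ⊙ γ r) n) (trans (⋆-scaleʳ x (γ r) E n)
        (trans (cong (x *_) (trans (γ-⋆ r E n) zeroTerm)) (*-zeroʳ x)))
      where
      zeroTerm : + (n C r) * E (n ∸ r) ≡ 0ℤ
      zeroTerm with r ℕ.≤? n
      ... | yes r≤n = trans (cong (+ (n C r) *_) (rec (s≤s (ℕₚ.m∸n≤m n r))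
                (λ r∣ → r∤ (subst (suc r ℕᵈ.∣_) (cong suc (ℕₚ.m+[n∸m]≡n r≤n)) (ℕᵈ.∣m∣n⇒∣m+n ℕᵈ.∣-refl r∣)))))
              (*-zeroʳ (+ (n C r)))
      ... | no  r≰n rewrite k>n⇒nCk≡0 {n} {r} (ℕₚ.≰⇒> r≰n) = *-zeroˡ (E (n ∸ r))

  -- The terms of d in degrees 1 … p - 2 are removed one at a time: exp(x sʳ⁺¹/(r+1)!) has no
  -- coefficient in degree p because r + 1 does not divide p.
  prime∣expH : ∀ m r {p} → Prime p → p ≡ suc (r ℕ.+ m) → 1 ≤ r → ∀ d → (∀ i → i < r → d i ≡ 0ℤ) →
               + p ∣ d (r ℕ.+ m) → + p ∣ expH d p
  prime∣expH zero r {p} pr refl 1≤r d dz p∣d =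
    subst (+ p ∣_) (sym (trans (expH-D d (r ℕ.+ 0)) (⋆-expand d (expH d) (r ℕ.+ 0)))) (sumℤ-∣ p term)
    where
    term : ∀ i → i < p → + p ∣ d i * (+ ((r ℕ.+ 0) C i) * expH d (r ℕ.+ 0 ∸ i))
    term i (s≤s i≤r) with i ℕ.≟ r ℕ.+ 0
    ... | yes refl = ∣m⇒∣m*n _ p∣d
    ... | no  i≢r  rewrite dz i (subst (i <_) (ℕₚ.+-identityʳ r) (ℕₚ.≤∧≢⇒< i≤r i≢r)) =
          ∣m⇒∣m*n (+ ((r ℕ.+ 0) C i) * expH d (r ℕ.+ 0 ∸ i)) ∣0
  prime∣expH (suc m) r {p} pr refl 1≤r d dz p∣d =
    subst (+ p ∣_) (sym (trans (expH-cong split p) (expH-⊞ (d r ⊙ γ r) d′ p)))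
      (prime∣⋆ pr (expH (d r ⊙ γ r)) (expH d′) (subst (+ p ∣_) (sym (expH-γ (d r) r p r∤p)) ∣0)
        (prime∣expH m (suc r) pr (cong suc (ℕₚ.+-suc r m)) (s≤s z≤n) d′ d′z p∣d′))
    where
    d′ : H
    d′ i = d i - d r * γ r i
    cancel : ∀ x y → x ≡ y + (x - y)
    cancel = solve-∀
    split : d ≗ (d r ⊙ γ r) ⊞ d′
    split i = cancel (d i) (d r * γ r i)
    drop0 : ∀ x y → x - y * 0ℤ ≡ x
    drop0 = solve-∀
    d′z : ∀ i → i < suc r → d′ i ≡ 0ℤ
    d′z i (s≤s i≤r) with i ℕ.≟ r
    ... | yes refl rewrite γ-diag i = trans (cong (λ x → d i - x) (*-identityʳ (d i))) (+-inverseʳ (d i))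
    ... | no  i≢r  rewrite γ-< {r} {i} (ℕₚ.≤∧≢⇒< i≤r i≢r) =
          trans (drop0 (d i) (d r)) (dz i (ℕₚ.≤∧≢⇒< i≤r i≢r))
    p∣d′ : + p ∣ d′ (suc r ℕ.+ m)
    p∣d′ rewrite γ-> {r} {suc (r ℕ.+ m)} (s≤s (ℕₚ.m≤m+n r m)) =
      subst (+ p ∣_) (trans (cong d (ℕₚ.+-suc r m)) (sym (drop0 (d (suc (r ℕ.+ m))) (d r)))) p∣d
    r<p : suc r < p
    r<p = s≤s (subst (suc r ≤_) (sym (ℕₚ.+-suc r m)) (s≤s (ℕₚ.m≤m+n r m)))
    r∤p : ¬ suc r ℕᵈ.∣ p
    r∤p r∣p with prime⇒irreducible pr r∣p
    ... | inj₁ refl = contradiction 1≤r λ ()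
    ... | inj₂ eq   = ℕₚ.<⇒≢ r<p eq

  -- F′ = Σ cₙ sⁿ as a Hurwitz series, the logarithmic derivative of exp F.
  logDeriv : (ℕ → ℤ) → H
  logDeriv c n = c n * fac n

  module _ (c : ℕ → ℤ) (c₀ : c 0 ≡ 1ℤ) where

    E : H
    E = expH (logDeriv c)

    E-1 : H
    E-1 n = E n - γ 0 n

    -- Comparison with the case c ≡ 1, where exp F = 1/(1 - s) has coefficients n!.
    prime∣E-p : ∀ {p} → Prime (suc p) → + suc p ∣ c p - 1ℤ → + suc p ∣ E (suc p)
    prime∣E-p {zero}  pr p∣ = 1∣ (E 1)
    prime∣E-p {suc p} pr p∣ =
      subst (+ P ∣_) (sym (trans (expH-cong split P) (expH-⊞ fac d P)))
        (prime∣⋆ pr (expH fac) (expH d) (subst (+ P ∣_) (sym (expH-fac P)) (∣⁺ (ℕᵈ.m∣m*n (suc p !))))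
          -- The removal of terms starts at r = 1. Degree 0 of d could not be removed in that way,
          -- since r + 1 = 1 divides every prime; it is absent because c₀ = 1.
          (prime∣expH p 1 pr refl ℕₚ.≤-refl d d₀ (∣m⇒∣m*n (fac (suc p)) p∣)))
      where
      P = suc (suc p)
      d : H
      d n = (c n - 1ℤ) * fac n
      lem : ∀ x y → x * y ≡ y + (x - 1ℤ) * y
      lem = solve-∀
      split : logDeriv c ≗ fac ⊞ d
      split n = lem (c n) (fac n)
      d₀ : ∀ i → i < 1 → d i ≡ 0ℤ
      d₀ zero    _        rewrite c₀ = refl
      d₀ (suc i) (s≤s ())

    -- Let P = suc p. In E (n + 1) = Σ cᵢ i! C(n,i) E (n - i) with n ≥ P, a term with n - i ≥ P is
    -- covered by induction, and in any other term i! C(n,i) = n!/(n - i)! contains P. For n + 1 = P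
    -- this argument fails, and `prime∣E-p` takes over.
    prime∣E : ∀ {p} → Prime (suc p) → + suc p ∣ c p - 1ℤ → ∀ n → suc p ≤ n → + suc p ∣ E n
    prime∣E {p} pr p∣ = <-rec _ step
      where
      step : ∀ n → (∀ {m} → m < n → suc p ≤ m → + suc p ∣ E m) → suc p ≤ n → + suc p ∣ E n
      step (suc n) rec (s≤s p≤n) with p ℕ.≟ n
      ... | yes refl = prime∣E-p pr p∣
      ... | no  p≢n  = subst (+ suc p ∣_) (sym (trans (expH-D (logDeriv c) n) (⋆-expand (logDeriv c) E n)))
                         (sumℤ-∣ (suc n) term)
        where
        rearrange : ∀ x y z w → (x * y) * (z * w) ≡ (x * w) * (z * y)
        rearrange = solve-∀
        term : ∀ i → i < suc n → + suc p ∣ logDeriv c i * (+ (n C i) * E (n ∸ i))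
        term i (s≤s i≤n) with suc p ℕ.≤? n ∸ i
        ... | yes p≤ = ∣n⇒∣m*n (logDeriv c i) (∣n⇒∣m*n (+ (n C i)) (rec (s≤s (ℕₚ.m∸n≤m n i)) p≤))
        ... | no  p≰ = subst (+ suc p ∣_) (sym (rearrange (c i) (fac i) (+ (n C i)) (E (n ∸ i))))
              (∣n⇒∣m*n (c i * E (n ∸ i)) (subst (+ suc p ∣_) (pos-* (n C i) (i !))
                (∣⁺ (prime∣C*! pr i≤n (ℕₚ.≤∧≢⇒< p≤n p≢n) (ℕₚ.≰⇒> p≰)))))

    -- `E-1` has no constant term, so the product starts in degree i + 1, and the hypothesis counts
    -- degrees from there.
    γ⋆E-1-∣ : ∀ {d} i → (∀ n → d ∣ + (suc (i ℕ.+ n) C i) * E (suc n)) → ∀ n → d ∣ (γ i ⋆ E-1) n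
    γ⋆E-1-∣ {d} i hyp n = subst (d ∣_) (sym (γ-⋆ i E-1 n)) coeff
      where
      coeff-at : i ≤ n → ∀ m → n ∸ i ≡ m → d ∣ + (n C i) * E-1 m
      coeff-at i≤n zero    _  = ∣n⇒∣m*n (+ (n C i)) ∣0
      coeff-at i≤n (suc m) eq =
        subst (d ∣_) (cong₂ _*_ (cong (λ x → + (x C i)) n≡) (sym (+-identityʳ (E (suc m))))) (hyp m)
        where
        n≡ : suc (i ℕ.+ m) ≡ n
        n≡ = trans (sym (ℕₚ.+-suc i m)) (trans (cong (i ℕ.+_) (sym eq)) (ℕₚ.m+[n∸m]≡n i≤n))
      coeff : d ∣ + (n C i) * E-1 (n ∸ i)
      coeff with i ℕ.≤? n
      ... | no  i≰n rewrite k>n⇒nCk≡0 {n} {i} (ℕₚ.≰⇒> i≰n) = ∣m⇒∣m*n (E-1 (n ∸ i)) ∣0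
      ... | yes i≤n = coeff-at i≤n (n ∸ i) refl

    -- Let P = suc p. The coefficient in degree p + m, with m ≥ 1, is C(p + m, p) · E m. If m ≥ P,
    -- then P divides E m; if m < P, both p and m lie below P while p + m does not, so P divides the
    -- binomial coefficient.
    prime∣γ⋆E-1 : ∀ {p} → Prime (suc p) → + suc p ∣ c p - 1ℤ → ∀ n → + suc p ∣ (γ p ⋆ E-1) n
    prime∣γ⋆E-1 {p} pr p∣ = γ⋆E-1-∣ p coeff
      where
      coeff : ∀ n → + suc p ∣ + (suc (p ℕ.+ n) C p) * E (suc n)
      coeff n with suc p ℕ.≤? suc n
      ... | yes p≤n = ∣n⇒∣m*n (+ (suc (p ℕ.+ n) C p)) (prime∣E pr p∣ (suc n) p≤n)
      ... | no  p≰n = ∣m⇒∣m*n (E (suc n)) (∣⁺ (prime∣C pr (ℕₚ.m≤n⇒m≤1+n (ℕₚ.m≤m+n p n)) (s≤s (ℕₚ.m≤m+n p n))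
          (subst (_< suc p) (sym (trans (cong (_∸ p) (sym (ℕₚ.+-suc p n))) (ℕₚ.m+n∸m≡n p (suc n)))) (ℕₚ.≰⇒> p≰n)) ℕₚ.≤-refl))

    -- Since E m is even for m ≥ 2, only m = 1 is left, and there the binomial coefficient C(4,3) =
    -- 4 is even.
    2∣γ₃⋆E-1 : + 2 ∣ c 1 - 1ℤ → ∀ n → + 2 ∣ (γ 3 ⋆ E-1) n
    2∣γ₃⋆E-1 2∣ = γ⋆E-1-∣ 3 coeff
      where
      coeff : ∀ n → + 2 ∣ + (suc (3 ℕ.+ n) C 3) * E (suc n)
      coeff zero    = ∣m⇒∣m*n (E 1) (divides (+ 2) refl)
      coeff (suc n) = ∣n⇒∣m*n (+ (suc (3 ℕ.+ suc n) C 3)) (prime∣E prime[2] 2∣ (suc (suc n)) (s≤s (s≤s z≤n)))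

  -- The series e^{xt} - 1 and the substitution of kt for t.

  pw : ℤ → H
  pw x n = x ^ n

  dilate : ℤ → H → H
  dilate x a n = x ^ n * a n

  dilate-⋆ : ∀ x a b → dilate x (a ⋆ b) ≗ dilate x a ⋆ dilate x b
  dilate-⋆ x a b zero    = lem (a 0) (b 0)
    where
    lem : ∀ y z → 1ℤ * (y * z) ≡ (1ℤ * y) * (1ℤ * z)
    lem = solve-∀
  dilate-⋆ x a b (suc n) = begin
    x * x ^ n * ((D a ⋆ b) n + (a ⋆ D b) n)
      ≡⟨ lem x (x ^ n) ((D a ⋆ b) n) ((a ⋆ D b) n) ⟩
    x * dilate x (D a ⋆ b) n + x * dilate x (a ⋆ D b) n
      ≡⟨ cong₂ (λ y z → x * y + x * z) (dilate-⋆ x (D a) b n) (dilate-⋆ x a (D b) n) ⟩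
    x * (dilate x (D a) ⋆ dilate x b) n + x * (dilate x a ⋆ dilate x (D b)) n
      ≡⟨ cong₂ _+_ (⋆-scaleʳ x (dilate x (D a)) (dilate x b) n) (⋆-scaleˡ x (dilate x a) (dilate x (D b)) n) ⟨
    ((x ⊙ dilate x (D a)) ⋆ dilate x b) n + (dilate x a ⋆ (x ⊙ dilate x (D b))) n
      ≡⟨ cong₂ _+_ (⋆-congʳ (dilate x b) (λ m → sym (*-assoc x (x ^ m) (a (suc m)))) n)
                   (⋆-congˡ (dilate x a) (λ m → sym (*-assoc x (x ^ m) (b (suc m)))) n) ⟩
    (dilate x a ⋆ dilate x b) (suc n) ∎
    where
    open ≡-Reasoning
    lem : ∀ x y z w → x * y * (z + w) ≡ x * (y * z) + x * (y * w)
    lem = solve-∀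

  pw-⋆ : ∀ x y → pw x ⋆ pw y ≗ pw (x + y)
  pw-⋆ x y zero    = refl
  pw-⋆ x y (suc n) = begin
    ((x ⊙ pw x) ⋆ pw y) n + (pw x ⋆ (y ⊙ pw y)) n
      ≡⟨ cong₂ _+_ (⋆-scaleʳ x (pw x) (pw y) n) (⋆-scaleˡ y (pw x) (pw y) n) ⟩
    x * (pw x ⋆ pw y) n + y * (pw x ⋆ pw y) n
      ≡⟨ *-distribʳ-+ ((pw x ⋆ pw y) n) x y ⟨
    (x + y) * (pw x ⋆ pw y) n
      ≡⟨ cong ((x + y) *_) (pw-⋆ x y n) ⟩
    (x + y) * (x + y) ^ n ∎
    where open ≡-Reasoning

  pw-∣ : ∀ {d x y} → d ∣ x - y → ∀ n → d ∣ pw x n - pw y n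
  pw-∣ e zero = ∣0
  pw-∣ {d} {x} {y} e (suc n) = subst (d ∣_) (lem x y (x ^ n) (y ^ n))
      (∣m∣n⇒∣m+n (∣n⇒∣m*n x (pw-∣ e n)) (∣m⇒∣m*n (y ^ n) e))
    where
    lem : ∀ x y u v → x * (u - v) + (x - y) * v ≡ x * u - y * v
    lem = solve-∀

  -- e^{xt} - 1
  pw-1 : ℤ → H
  pw-1 x n = pw x n - γ 0 n

  pw-1-+ : ∀ x y → pw-1 (x + y) ≗ pw x ⋆ pw-1 y ⊞ pw-1 x
  pw-1-+ x y n = begin
    pw (x + y) n - γ 0 n                         ≡⟨ lem (pw (x + y) n) (pw x n) (γ 0 n) ⟩
    (pw (x + y) n + - 1ℤ * pw x n) + pw-1 x n    ≡⟨ cong (_+ pw-1 x n) (cong₂ (λ u v → u + - 1ℤ * v)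
                                                     (pw-⋆ x y n) (trans (⋆-comm (pw x) (γ 0) n) (⋆-identityˡ (pw x) n))) ⟨
    ((pw x ⋆ pw y) n + - 1ℤ * (pw x ⋆ γ 0) n) + pw-1 x n ≡⟨ cong (λ u → ((pw x ⋆ pw y) n + u) + pw-1 x n) (⋆-scaleˡ (- 1ℤ) (pw x) (γ 0) n) ⟨
    ((pw x ⋆ pw y) n + (pw x ⋆ ((- 1ℤ) ⊙ γ 0)) n) + pw-1 x n ≡⟨ cong (_+ pw-1 x n) (⋆-distribˡ (pw x) (pw y) ((- 1ℤ) ⊙ γ 0) n) ⟨
    (pw x ⋆ (pw y ⊞ (- 1ℤ) ⊙ γ 0)) n + pw-1 x n   ≡⟨ cong (_+ pw-1 x n) (⋆-congˡ (pw x) (λ m → cong (λ z → pw y m + z) (-1*i≡-i (γ 0 m))) n) ⟩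
    (pw x ⋆ pw-1 y) n + pw-1 x n                 ∎
    where
    open ≡-Reasoning
    lem : ∀ u v w → u - w ≡ (u + - 1ℤ * v) + (v - w)
    lem = solve-∀

  -- In the Hurwitz ring e^{xmt} - 1 is a multiple of e^{xt} - 1, by repeated use of e^{(x+y)t} - 1
  -- = e^{xt}(e^{yt} - 1) + (e^{xt} - 1). A natural number m makes this an induction.
  ∣⋆pw-1-* : ∀ {d} a x → (∀ n → d ∣ (a ⋆ pw-1 x) n) → ∀ m n → d ∣ (a ⋆ pw-1 (x * + m)) n
  ∣⋆pw-1-* {d} a x e zero n = ⋆-∣ʳ a zeros n
    where
    zeros : ∀ j → d ∣ pw-1 (x * 0ℤ) j
    zeros zero    = ∣0
    zeros (suc j) rewrite *-zeroʳ x = ∣0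
  ∣⋆pw-1-* {d} a x e (suc m) n = subst (d ∣_) (sym eq)
      (∣m∣n⇒∣m+n (⋆-∣ʳ (pw x) (∣⋆pw-1-* a x e m) n) (e n))
    where
    open ≡-Reasoning
    lem : ∀ x y → x * (1ℤ + y) ≡ x + x * y
    lem = solve-∀
    y = x * + m
    eq : (a ⋆ pw-1 (x * + suc m)) n ≡ (pw x ⋆ (a ⋆ pw-1 y)) n + (a ⋆ pw-1 x) n
    eq = begin
      (a ⋆ pw-1 (x * + suc m)) n                ≡⟨ cong (λ z → (a ⋆ pw-1 z) n) (lem x (+ m)) ⟩
      (a ⋆ pw-1 (x + y)) n                      ≡⟨ ⋆-congˡ a (pw-1-+ x y) n ⟩
      (a ⋆ (pw x ⋆ pw-1 y ⊞ pw-1 x)) n          ≡⟨ ⋆-distribˡ a (pw x ⋆ pw-1 y) (pw-1 x) n ⟩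
      (a ⋆ (pw x ⋆ pw-1 y)) n + (a ⋆ pw-1 x) n  ≡⟨ cong (_+ (a ⋆ pw-1 x) n) (⋆-swapˡ a (pw x) (pw-1 y) n) ⟩
      (pw x ⋆ (a ⋆ pw-1 y)) n + (a ⋆ pw-1 x) n  ∎

  solveMod : ∀ {p k} → Prime p → ¬ p ℕᵈ.∣ k → ∀ h → ∃ λ m → + p ∣ + h - + k * + m
  solveMod {p} {k} pr p∤k h with coprime-Bézout (prime∤⇒coprime pr p∤k)
  ... | Bézout.+- x y eq = h ℕ.* x , divides (- (+ h * + y)) (begin
          + h - + k * + (h ℕ.* x)          ≡⟨ cong (λ z → + h - + k * z) (pos-* h x) ⟩
          + h - + k * (+ h * + x)          ≡⟨ lem₁ (+ h) (+ k) (+ x) ⟩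
          + h - + h * (+ x * + k)          ≡⟨ cong (λ z → + h - + h * z) eq′ ⟨
          + h - + h * (1ℤ + + y * + p)     ≡⟨ lem₂ (+ h) (+ y) (+ p) ⟩
          - (+ h * + y) * + p              ∎)
    where
    open ≡-Reasoning
    eq′ : 1ℤ + + y * + p ≡ + x * + k
    eq′ = trans (cong (λ z → 1ℤ + z) (sym (pos-* y p))) (trans (cong +_ eq) (pos-* x k))
    lem₁ : ∀ h k x → h - k * (h * x) ≡ h - h * (x * k)
    lem₁ = solve-∀
    lem₂ : ∀ h y p → h - h * (1ℤ + y * p) ≡ - (h * y) * p
    lem₂ = solve-∀
  -- Now -x inverts k mod p. Since m has to be a natural number, -x is replaced by x²k, which is
  -- congruent to it.
  ... | Bézout.-+ x y eq = h ℕ.* (x ℕ.* x ℕ.* k) , divides (+ h * (+ y * (+ 2 - + y * + p))) (begin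
          + h - + k * + (h ℕ.* (x ℕ.* x ℕ.* k))
            ≡⟨ cong (λ z → + h - + k * z) (trans (pos-* h (x ℕ.* x ℕ.* k)) (cong (+ h *_)
                 (trans (pos-* (x ℕ.* x) k) (cong (_* + k) (pos-* x x))))) ⟩
          + h - + k * (+ h * (+ x * + x * + k))
            ≡⟨ lem₁ (+ h) (+ k) (+ x) ⟩
          + h - + h * ((1ℤ + + x * + k - 1ℤ) * (1ℤ + + x * + k - 1ℤ))
            ≡⟨ cong (λ z → + h - + h * ((z - 1ℤ) * (z - 1ℤ))) eq′ ⟩
          + h - + h * ((+ y * + p - 1ℤ) * (+ y * + p - 1ℤ))
            ≡⟨ lem₂ (+ h) (+ y) (+ p) ⟩
          + h * (+ y * (+ 2 - + y * + p)) * + p ∎)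
    where
    open ≡-Reasoning
    eq′ : 1ℤ + + x * + k ≡ + y * + p
    eq′ = trans (cong (λ z → 1ℤ + z) (sym (pos-* x k))) (trans (cong +_ eq) (pos-* y p))
    lem₁ : ∀ h k x → h - k * (h * (x * x * k)) ≡ h - h * ((1ℤ + x * k - 1ℤ) * (1ℤ + x * k - 1ℤ))
    lem₁ = solve-∀
    lem₂ : ∀ h y p → h - h * ((y * p - 1ℤ) * (y * p - 1ℤ)) ≡ h * (y * (+ 2 - y * p)) * p
    lem₂ = solve-∀

  -- Divided powers of G and the claim for a single index.

  powH : H → ℕ → H
  powH a zero    = γ 0
  powH a (suc i) = a ⋆ powH a i

  γ-scale : ∀ i m → + suc m * γ i m ≡ + suc i * γ i m
  γ-scale i m with ℕₚ.<-cmp i m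
  ... | tri≈ _ refl _ = refl
  ... | tri< i<m _ _ rewrite γ-> i<m = trans (*-zeroʳ (+ suc m)) (sym (*-zeroʳ (+ suc i)))
  ... | tri> _ _ m<i rewrite γ-< m<i = trans (*-zeroʳ (+ suc m)) (sym (*-zeroʳ (+ suc i)))

  γ₁⋆γ : ∀ i → γ 1 ⋆ γ i ≗ + suc i ⊙ γ (suc i)
  γ₁⋆γ i zero    = trans (*-zeroˡ (γ i 0)) (sym (*-zeroʳ (+ suc i)))
  γ₁⋆γ i (suc m) = trans (γ-⋆ 1 (γ i) (suc m))
    (trans (cong (λ x → + x * γ i m) (nC1≡n (suc m))) (γ-scale i m))

  module Composition (c : ℕ → ℤ) (c₀ : c 0 ≡ 1ℤ) where

    -- These are F′ and 1/F′. From G′ = 1/F′(G) = q(G), the operator `Φ q` is substitution of G.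
    f q : H
    f = logDeriv c
    q = invH f

    f⋆q : f ⋆ q ≗ γ 0
    f⋆q = invH-inverse f (trans (*-identityʳ (c 0)) c₀)

    q⋆f⋆ : ∀ a → q ⋆ (f ⋆ a) ≗ a
    q⋆f⋆ a n = begin
      (q ⋆ (f ⋆ a)) n  ≡⟨ ⋆-swapˡ q f a n ⟩
      (f ⋆ (q ⋆ a)) n  ≡⟨ ⋆-assoc f q a n ⟨
      ((f ⋆ q) ⋆ a) n  ≡⟨ ⋆-congʳ a f⋆q n ⟩
      (γ 0 ⋆ a) n      ≡⟨ ⋆-identityˡ a n ⟩
      a n              ∎
      where open ≡-Reasoning

    -- The operator q d/ds fixes exp F, because (exp F)′ = F′ exp F. Hence every coefficient of the
    -- composite is the value of exp F at 0, which is 1.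
    Φ-E : Φ q (E c c₀) ≗ pw 1ℤ
    Φ-E zero    = refl
    Φ-E (suc n) = trans (Φ-cong q (λ m → trans (⋆-congˡ q (expH-D f) m) (q⋆f⋆ (E c c₀) m)) n)
                        (trans (Φ-E n) (sym (*-identityˡ (1ℤ ^ n))))

    -- A i = Gⁱ / i!
    A : ℕ → H
    A i = Φ q (γ i)

    A-0 : ∀ i → 1 ≤ i → A i 0 ≡ 0ℤ
    A-0 (suc i) _ = refl

    Φ-E-1 : Φ q (E-1 c c₀) ≗ pw-1 1ℤ
    Φ-E-1 n = begin
      Φ q (E-1 c c₀) n                          ≡⟨ Φ-cong q (λ m → cong (λ z → E c c₀ m + z) (sym (-1*i≡-i (γ 0 m)))) n ⟩
      Φ q (E c c₀ ⊞ (- 1ℤ) ⊙ γ 0) n             ≡⟨ Φ-⊞ q (E c c₀) ((- 1ℤ) ⊙ γ 0) n ⟩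
      Φ q (E c c₀) n + Φ q ((- 1ℤ) ⊙ γ 0) n     ≡⟨ cong₂ _+_ (Φ-E n) (trans (Φ-⊙ q (- 1ℤ) (γ 0) n)
                                                     (trans (cong (- 1ℤ *_) (Φ-1 q n)) (-1*i≡-i (γ 0 n)))) ⟩
      pw-1 1ℤ n                                 ∎
      where open ≡-Reasoning

    pw-1-dilate : ∀ k → dilate k (pw-1 1ℤ) ≗ pw-1 k
    pw-1-dilate k zero    = refl
    pw-1-dilate k (suc n) = begin
      k ^ suc n * (1ℤ ^ suc n - 0ℤ)  ≡⟨ cong (λ z → k ^ suc n * (z - 0ℤ)) (^-zeroˡ (suc n)) ⟩
      k ^ suc n * 1ℤ                 ≡⟨ *-identityʳ (k ^ suc n) ⟩
      k ^ suc n                      ≡⟨ +-identityʳ (k ^ suc n) ⟨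
      k ^ suc n - 0ℤ                 ∎
      where open ≡-Reasoning

    prime∣A⋆pw-1 : ∀ {p i} → Prime p → 1 ≤ i → (∀ n → + p ∣ (γ i ⋆ E-1 c c₀) n) →
                   ∀ h k n → + p ∣ (dilate (+ k) (A i) ⋆ pw-1 (+ h)) n
    prime∣A⋆pw-1 {p} {i} pr 1≤i p∣ h k with p ℕᵈ.∣? k
    -- The factor p comes from kⁿ with n ≥ 1; degree 0 is harmless because Gⁱ has no constant term
    -- for i ≥ 1.
    ... | yes p∣k = ⋆-∣ (pw-1 (+ h)) p∣dilate
      where
      p∣dilate : ∀ n → + p ∣ dilate (+ k) (A i) n
      p∣dilate zero    rewrite A-0 i 1≤i = ∣0
      p∣dilate (suc n) = ∣m⇒∣m*n (A i (suc n)) (∣m⇒∣m*n ((+ k) ^ n) (∣⁺ p∣k))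
    ... | no  p∤k with solveMod pr p∤k h
    ...   | m , p∣h-km = λ n → subst (+ p ∣_) (sym (split n))
              (∣m∣n⇒∣m+n (∣⋆pw-1-* Ak (+ k) p∣k m n) (⋆-∣ʳ Ak (pw-∣ p∣h-km) n))
      where
      open ≡-Reasoning
      Ak : H
      Ak = dilate (+ k) (A i)
      -- `Φ q` and `dilate` are multiplicative and keep divisibility by p; together they turn exp F
      -- - 1 into e^{kt} - 1.
      p∣k : ∀ n → + p ∣ (Ak ⋆ pw-1 (+ k)) n
      p∣k n = subst (+ p ∣_) (begin
        (+ k) ^ n * Φ q (γ i ⋆ E-1 c c₀) n      ≡⟨ cong ((+ k) ^ n *_) (Φ-⋆ q (γ i) (E-1 c c₀) n) ⟩
        dilate (+ k) (A i ⋆ Φ q (E-1 c c₀)) n   ≡⟨ dilate-⋆ (+ k) (A i) (Φ q (E-1 c c₀)) n ⟩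
        (Ak ⋆ dilate (+ k) (Φ q (E-1 c c₀))) n  ≡⟨ ⋆-congˡ Ak (λ j → trans (cong ((+ k) ^ j *_) (Φ-E-1 j)) (pw-1-dilate (+ k) j)) n ⟩
        (Ak ⋆ pw-1 (+ k)) n                     ∎) (∣n⇒∣m*n ((+ k) ^ n) (Φ-∣ q p∣ n))
      lem : ∀ x y z → x - z ≡ (y - z) + (x - y)
      lem = solve-∀
      split : ∀ n → (Ak ⋆ pw-1 (+ h)) n ≡ (Ak ⋆ pw-1 (+ k * + m)) n + (Ak ⋆ (λ j → pw (+ h) j - pw (+ k * + m) j)) n
      split n = trans (⋆-congˡ Ak (λ j → lem (pw (+ h) j) (pw (+ k * + m) j) (γ 0 j)) n)
                      (⋆-distribˡ Ak (pw-1 (+ k * + m)) (λ j → pw (+ h) j - pw (+ k * + m) j) n)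

    powA : ∀ i → powH (A 1) i ≗ fac i ⊙ A i
    powA zero    n = trans (sym (Φ-1 q n)) (sym (*-identityˡ (A 0 n)))
    powA (suc i) n = begin
      (A 1 ⋆ powH (A 1) i) n             ≡⟨ ⋆-congˡ (A 1) (powA i) n ⟩
      (A 1 ⋆ (fac i ⊙ A i)) n            ≡⟨ ⋆-scaleˡ (fac i) (A 1) (A i) n ⟩
      fac i * (A 1 ⋆ A i) n              ≡⟨ cong (fac i *_) (Φ-⋆ q (γ 1) (γ i) n) ⟨
      fac i * Φ q (γ 1 ⋆ γ i) n          ≡⟨ cong (fac i *_) (trans (Φ-cong q (γ₁⋆γ i) n) (Φ-⊙ q (+ suc i) (γ (suc i)) n)) ⟩
      fac i * (+ suc i * A (suc i) n)    ≡⟨ lem (fac i) (+ suc i) (A (suc i) n) ⟩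
      (+ suc i * fac i) * A (suc i) n    ≡⟨ cong (_* A (suc i) n) (pos-* (suc i) (i !)) ⟨
      fac (suc i) * A (suc i) n          ∎
      where
      open ≡-Reasoning
      lem : ∀ x y z → x * (y * z) ≡ (y * x) * z
      lem = solve-∀

    -- Of the two factors 2, one is in 3! = 6. The other comes from c₃ or, when c₁ is odd, from the
    -- series: c₁ is c_{p-1} for p = 2, so its oddness makes the coefficients of exp F even from
    -- degree 2 on.
    4∣term : (+ 2 ∣ c 3) ⊎ (+ 2 ∣ c 1 - 1ℤ) → ∀ h k n →
             + 4 ∣ c 3 * (fac 3 * (dilate (+ k) (A 3) ⋆ pw-1 (+ h)) n)
    4∣term (inj₁ (divides z eq)) h k n = divides (z * + 3 * X) (trans (cong (_* (+ 6 * X)) eq) (lem z X))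
      where
      X = (dilate (+ k) (A 3) ⋆ pw-1 (+ h)) n
      lem : ∀ z X → z * + 2 * (+ 6 * X) ≡ z * + 3 * X * + 4
      lem = solve-∀
    4∣term (inj₂ 2∣c₁-1) h k n with prime∣A⋆pw-1 prime[2] (s≤s z≤n) (2∣γ₃⋆E-1 c c₀ 2∣c₁-1) h k n
    ... | divides z eq = divides (c 3 * (+ 3 * z)) (trans (cong (λ x → c 3 * (+ 6 * x)) eq) (lem (c 3) z))
      where
      lem : ∀ c z → c * (+ 6 * (z * + 2)) ≡ c * (+ 3 * z) * + 4
      lem = solve-∀

    suc∣term : (∀ p → Prime (suc p) → (+ suc p ∣ c p) ⊎ (+ suc p ∣ c p - 1ℤ)) →
               (+ 2 ∣ c 3) ⊎ (+ 2 ∣ c 1 - 1ℤ) → ∀ i h k n →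
               + suc i ∣ c i * (fac i * (dilate (+ k) (A i) ⋆ pw-1 (+ h)) n)
    suc∣term c-prime c-four zero h k n = 1∣ _
    suc∣term c-prime c-four i@(suc _) h k n with prime? (suc i)
    suc∣term c-prime c-four i@(suc _) h k n | yes pr with c-prime i pr
    ... | inj₁ p∣c   = ∣m⇒∣m*n _ p∣c
    ... | inj₂ p∣c-1 = ∣n⇒∣m*n (c i) (∣n⇒∣m*n (fac i)
          (prime∣A⋆pw-1 pr (s≤s z≤n) (prime∣γ⋆E-1 c c₀ pr p∣c-1) h k n))
    suc∣term c-prime c-four i@(suc _) h k n | no ¬pr with i ℕ.≟ 3
    ... | yes refl = 4∣term c-four h k n
    ... | no  i≢3  = ∣n⇒∣m*n (c i) (∣m⇒∣m*n _
          (∣⁺ (composite∣! i (¬prime⇒composite ¬pr) (λ e → i≢3 (ℕₚ.suc-injective e)))))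

-- Power series over the rationals and uniqueness of inverses.

module RationalSeries where

  open import Defs
  open HurwitzSeries
  open FactorialDivisibility using (nCk*[k!*[n∸k]!]≡n!)
  open import Data.Nat as ℕ using (ℕ; zero; suc; _≤_; _<_; z≤n; s≤s; _∸_; _!)
  import Data.Nat.Properties as ℕₚ
  open import Data.Nat.Combinatorics using (_C_)
  open import Data.Integer as ℤ using (ℤ; +_; 0ℤ; 1ℤ)
  import Data.Integer.Properties as ℤₚ
  open import Data.Rational using (ℚ; 0ℚ; 1ℚ; _+_; _*_; _-_; _/_; toℚᵘ)
  open import Data.Rational.Properties
  open import Algebra.Properties.Group +-0-group using () renaming (∙-cancelˡ to +-cancelˡ; ∙-cancelʳ to +-cancelʳ)
  import Data.Rational.Unnormalised as ℚᵘ
  import Data.Rational.Unnormalised.Properties as ℚᵘₚ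
  import Tactic.RingSolver.Core.AlmostCommutativeRing as ACR
  open import Tactic.RingSolver using (solve-∀)
  open import Relation.Nullary.Decidable using (dec⇒maybe)
  open import Data.Product using (∃; _,_)
  open import Data.Sum using (inj₁; inj₂)
  open import Level using (0ℓ)
  open import Relation.Nullary using (yes; no)
  open import Relation.Binary.PropositionalEquality

  ℚ-ring : ACR.AlmostCommutativeRing 0ℓ 0ℓ
  ℚ-ring = ACR.fromCommutativeRing +-*-commutativeRing (λ x → dec⇒maybe (0ℚ ≟ x))

  toℚᵘ-/ : ∀ z d → toℚᵘ (z / suc d) ℚᵘ.≃ ℚᵘ.mkℚᵘ z d
  toℚᵘ-/ z d = toℚᵘ-fromℚᵘ (ℚᵘ.mkℚᵘ z d)

  ι-+ : ∀ a b → ι (a ℤ.+ b) ≡ ι a + ι b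
  ι-+ a b = toℚᵘ-injective (begin
    toℚᵘ (ι (a ℤ.+ b))                     ≈⟨ toℚᵘ-/ (a ℤ.+ b) 0 ⟩
    ℚᵘ.mkℚᵘ (a ℤ.+ b) 0                    ≈⟨ ℚᵘ.*≡* (cong₂ ℤ._*_ (sym (cong₂ ℤ._+_ (ℤₚ.*-identityʳ a) (ℤₚ.*-identityʳ b))) refl) ⟩
    ℚᵘ.mkℚᵘ a 0 ℚᵘ.+ ℚᵘ.mkℚᵘ b 0           ≈⟨ ℚᵘₚ.+-cong (toℚᵘ-/ a 0) (toℚᵘ-/ b 0) ⟨
    toℚᵘ (ι a) ℚᵘ.+ toℚᵘ (ι b)             ≈⟨ toℚᵘ-homo-+ (ι a) (ι b) ⟨
    toℚᵘ (ι a + ι b)                       ∎)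
    where open ℚᵘₚ.≃-Reasoning

  ι-* : ∀ a b → ι (a ℤ.* b) ≡ ι a * ι b
  ι-* a b = toℚᵘ-injective (begin
    toℚᵘ (ι (a ℤ.* b))                     ≈⟨ toℚᵘ-/ (a ℤ.* b) 0 ⟩
    ℚᵘ.mkℚᵘ a 0 ℚᵘ.* ℚᵘ.mkℚᵘ b 0           ≈⟨ ℚᵘₚ.*-cong (toℚᵘ-/ a 0) (toℚᵘ-/ b 0) ⟨
    toℚᵘ (ι a) ℚᵘ.* toℚᵘ (ι b)             ≈⟨ toℚᵘ-homo-* (ι a) (ι b) ⟨
    toℚᵘ (ι a * ι b)                       ∎)
    where open ℚᵘₚ.≃-Reasoning

  ι-minus : ∀ a b → ι (a ℤ.- b) ≡ ι a - ι b
  ι-minus a b = begin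
    ι (a ℤ.- b)               ≡⟨ lem (ι (a ℤ.- b)) (ι b) ⟩
    (ι (a ℤ.- b) + ι b) - ι b ≡⟨ cong (_- ι b) (ι-+ (a ℤ.- b) b) ⟨
    ι ((a ℤ.- b) ℤ.+ b) - ι b ≡⟨ cong (λ z → ι z - ι b) (trans (ℤₚ.+-assoc a (ℤ.- b) b)
                                  (trans (cong (λ z → a ℤ.+ z) (ℤₚ.+-inverseˡ b)) (ℤₚ.+-identityʳ a))) ⟩
    ι a - ι b                 ∎
    where
    open ≡-Reasoning
    lem : ∀ x y → x ≡ (x + y) - y
    lem = solve-∀ ℚ-ring

  /-cancel : ∀ z d .{{_ : ℕ.NonZero d}} → (z / d) * ι (+ d) ≡ ι z
  /-cancel z (suc d) = toℚᵘ-injective (begin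
    toℚᵘ ((z / suc d) * ι (+ suc d))              ≈⟨ toℚᵘ-homo-* (z / suc d) (ι (+ suc d)) ⟩
    toℚᵘ (z / suc d) ℚᵘ.* toℚᵘ (ι (+ suc d))      ≈⟨ ℚᵘₚ.*-cong (toℚᵘ-/ z d) (toℚᵘ-/ (+ suc d) 0) ⟩
    ℚᵘ.mkℚᵘ z d ℚᵘ.* ℚᵘ.mkℚᵘ (+ suc d) 0          ≈⟨ ℚᵘ.*≡* (ℤₚ.*-assoc z (+ suc d) 1ℤ) ⟩
    ℚᵘ.mkℚᵘ z 0                                   ≈⟨ toℚᵘ-/ z 0 ⟨
    toℚᵘ (ι z)                                    ∎)
    where open ℚᵘₚ.≃-Reasoning

  inv!-cancel : ∀ n → inv! n * ι (+ (n !)) ≡ 1ℚ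
  inv!-cancel n = /-cancel 1ℤ (n !) {{n ℕₚ.!≢0}}

  ι-sumℤ : ∀ n f → ι (sumℤ n f) ≡ Σ< n (λ i → ι (f i))
  ι-sumℤ zero    f = refl
  ι-sumℤ (suc n) f = trans (ι-+ (sumℤ n f) (f n)) (cong (_+ ι (f n)) (ι-sumℤ n f))

  ι-^ : ∀ z n → ι (z ℤ.^ n) ≡ ι z ^ℚ n
  ι-^ z zero    = refl
  ι-^ z (suc n) = trans (ι-* z (z ℤ.^ n)) (cong (ι z *_) (ι-^ z n))

  Σ-cong : ∀ n {f g} → (∀ i → i < n → f i ≡ g i) → Σ< n f ≡ Σ< n g
  Σ-cong zero    e = refl
  Σ-cong (suc n) e = cong₂ _+_ (Σ-cong n (λ i l → e i (ℕₚ.m≤n⇒m≤1+n l))) (e n ℕₚ.≤-refl)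

  Σ-*ˡ : ∀ n x f → x * Σ< n f ≡ Σ< n (λ i → x * f i)
  Σ-*ˡ zero    x f = *-zeroʳ x
  Σ-*ˡ (suc n) x f = trans (*-distribˡ-+ x (Σ< n f) (f n)) (cong (_+ x * f n) (Σ-*ˡ n x f))

  Σ-*ʳ : ∀ n x f → Σ< n f * x ≡ Σ< n (λ i → f i * x)
  Σ-*ʳ n x f = trans (*-comm (Σ< n f) x) (trans (Σ-*ˡ n x f) (Σ-cong n (λ i _ → *-comm x (f i))))

  Σ-+ : ∀ n f g → Σ< n f + Σ< n g ≡ Σ< n (λ i → f i + g i)
  Σ-+ zero    f g = refl
  Σ-+ (suc n) f g = trans (lem (Σ< n f) (f n) (Σ< n g) (g n)) (cong (_+ (f n + g n)) (Σ-+ n f g))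
    where
    lem : ∀ a b c d → (a + b) + (c + d) ≡ (a + c) + (b + d)
    lem = solve-∀ ℚ-ring

  Σ-minus : ∀ n f g → Σ< n f - Σ< n g ≡ Σ< n (λ i → f i - g i)
  Σ-minus zero    f g = refl
  Σ-minus (suc n) f g = trans (lem (Σ< n f) (f n) (Σ< n g) (g n)) (cong (_+ (f n - g n)) (Σ-minus n f g))
    where
    lem : ∀ a b c d → (a + b) - (c + d) ≡ (a - c) + (b - d)
    lem = solve-∀ ℚ-ring

  Σ-0 : ∀ n {f} → (∀ i → i < n → f i ≡ 0ℚ) → Σ< n f ≡ 0ℚ
  Σ-0 zero    e = refl
  Σ-0 (suc n) e = cong₂ _+_ (Σ-0 n (λ i l → e i (ℕₚ.m≤n⇒m≤1+n l))) (e n ℕₚ.≤-refl)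

  Σ-swap : ∀ n m (f : ℕ → ℕ → ℚ) → Σ< n (λ i → Σ< m (f i)) ≡ Σ< m (λ j → Σ< n (λ i → f i j))
  Σ-swap zero    m f = sym (Σ-0 m (λ _ _ → refl))
  Σ-swap (suc n) m f = trans (cong (_+ Σ< m (f n)) (Σ-swap n m f)) (Σ-+ m (λ j → Σ< n (λ i → f i j)) (f n))

  Σ-head : ∀ n f → Σ< (suc n) f ≡ f 0 + Σ< n (λ i → f (suc i))
  Σ-head zero    f = +-comm 0ℚ (f 0)
  Σ-head (suc n) f = trans (cong (_+ f (suc n)) (Σ-head n f)) (+-assoc (f 0) _ (f (suc n)))

  Σ-extend : ∀ n {M f} → n ≤ M → (∀ i → n ≤ i → f i ≡ 0ℚ) → Σ< M f ≡ Σ< n f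
  Σ-extend n {M} n≤M e with ℕₚ.m≤n⇒m<n∨m≡n n≤M
  ... | inj₂ refl = refl
  Σ-extend n {suc M} {f} n≤M e | inj₁ (s≤s n≤M′) =
    trans (cong₂ _+_ (Σ-extend n n≤M′ e) (e M n≤M′)) (+-identityʳ (Σ< n f))

  Σ-integral : ∀ n {f} → (∀ i → ∃ λ z → f i ≡ ι z) → ∃ λ z → Σ< n f ≡ ι z
  Σ-integral zero    e = 0ℤ , refl
  Σ-integral (suc n) e with Σ-integral n e | e n
  ... | z , p | w , r = z ℤ.+ w , trans (cong₂ _+_ p r) (sym (ι-+ z w))

  ⊛-local : ∀ n {f f′ g g′} → (∀ j → j ≤ n → f j ≡ f′ j) → (∀ j → j ≤ n → g j ≡ g′ j) → (f ⊛ g) n ≡ (f′ ⊛ g′) n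
  ⊛-local n e e′ = Σ-cong (suc n) (λ { i (s≤s l) → cong₂ _*_ (e i l) (e′ (n ∸ i) (ℕₚ.m∸n≤m n i)) })

  ⊛-cong : ∀ {f f′ g g′} → f ≗ f′ → g ≗ g′ → f ⊛ g ≗ f′ ⊛ g′
  ⊛-cong e e′ n = ⊛-local n (λ j _ → e j) (λ j _ → e′ j)

  ⊛-minusʳ : ∀ f a b n → (f ⊛ a) n - (f ⊛ b) n ≡ (f ⊛ (λ j → a j - b j)) n
  ⊛-minusʳ f a b n = trans (Σ-minus (suc n) _ _) (Σ-cong (suc n) (λ i _ → lem (f i) (a (n ∸ i)) (b (n ∸ i))))
    where
    lem : ∀ x y z → x * y - x * z ≡ x * (y - z)
    lem = solve-∀ ℚ-ring

  -- The inclusion of Hurwitz series into ordinary power series; `N-⋆` makes it multiplicative.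
  N : H → Series
  N a n = ι (a n) * inv! n

  C-inv! : ∀ {n i} → i ≤ n → ι (+ (n C i)) * inv! n ≡ inv! i * inv! (n ∸ i)
  C-inv! {n} {i} i≤n = begin
    B * w                            ≡⟨ lem₁ B w ⟩
    (B * w) * (1ℚ * 1ℚ)              ≡⟨ cong₂ (λ x y → (B * w) * (x * y)) (inv!-cancel i) (inv!-cancel (n ∸ i)) ⟨
    (B * w) * ((u * I) * (v * K))    ≡⟨ lem₂ B w u I v K ⟩
    (w * (B * (I * K))) * (u * v)    ≡⟨ cong (λ x → (w * x) * (u * v)) BIK ⟩
    (w * ι (+ (n !))) * (u * v)      ≡⟨ cong (_* (u * v)) (inv!-cancel n) ⟩
    1ℚ * (u * v)                     ≡⟨ *-identityˡ (u * v) ⟩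
    u * v                            ∎
    where
    open ≡-Reasoning
    B = ι (+ (n C i)) ; u = inv! i ; v = inv! (n ∸ i) ; w = inv! n
    I = ι (+ (i !)) ; K = ι (+ ((n ∸ i) !))
    lem₁ : ∀ x y → x * y ≡ (x * y) * (1ℚ * 1ℚ)
    lem₁ = solve-∀ ℚ-ring
    lem₂ : ∀ B w u I v K → (B * w) * ((u * I) * (v * K)) ≡ (w * (B * (I * K))) * (u * v)
    lem₂ = solve-∀ ℚ-ring
    BIK : B * (I * K) ≡ ι (+ (n !))
    BIK = trans (cong (B *_) (sym (ι-* (+ (i !)) (+ ((n ∸ i) !)))))
         (trans (sym (ι-* (+ (n C i)) (+ (i !) ℤ.* + ((n ∸ i) !))))
         (cong ι (trans (cong (λ x → + (n C i) ℤ.* x) (sym (ℤₚ.pos-* (i !) ((n ∸ i) !))))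
           (trans (sym (ℤₚ.pos-* (n C i) (i ! ℕ.* (n ∸ i) !))) (cong +_ (nCk*[k!*[n∸k]!]≡n! i≤n))))))

  N-⋆ : ∀ a b → N (a ⋆ b) ≗ N a ⊛ N b
  N-⋆ a b n = begin
    ι ((a ⋆ b) n) * inv! n                 ≡⟨ cong (λ x → ι x * inv! n) (⋆-expand a b n) ⟩
    ι (sumℤ (suc n) t) * inv! n            ≡⟨ cong (_* inv! n) (ι-sumℤ (suc n) t) ⟩
    Σ< (suc n) (λ i → ι (t i)) * inv! n    ≡⟨ Σ-*ʳ (suc n) (inv! n) (λ i → ι (t i)) ⟩
    Σ< (suc n) (λ i → ι (t i) * inv! n)    ≡⟨ Σ-cong (suc n) (λ { i (s≤s l) → term i l }) ⟩
    (N a ⊛ N b) n                          ∎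
    where
    open ≡-Reasoning
    t : H
    t i = a i ℤ.* (+ (n C i) ℤ.* b (n ∸ i))
    lem₁ : ∀ x y z w → (x * (y * z)) * w ≡ (x * z) * (y * w)
    lem₁ = solve-∀ ℚ-ring
    lem₂ : ∀ x z u v → (x * z) * (u * v) ≡ (x * u) * (z * v)
    lem₂ = solve-∀ ℚ-ring
    term : ∀ i → i ≤ n → ι (t i) * inv! n ≡ N a i * N b (n ∸ i)
    term i i≤n = begin
      ι (t i) * inv! n
        ≡⟨ cong (_* inv! n) (trans (ι-* (a i) _) (cong (ι (a i) *_) (ι-* (+ (n C i)) (b (n ∸ i))))) ⟩
      (ι (a i) * (ι (+ (n C i)) * ι (b (n ∸ i)))) * inv! n
        ≡⟨ lem₁ (ι (a i)) (ι (+ (n C i))) (ι (b (n ∸ i))) (inv! n) ⟩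
      (ι (a i) * ι (b (n ∸ i))) * (ι (+ (n C i)) * inv! n)
        ≡⟨ cong ((ι (a i) * ι (b (n ∸ i))) *_) (C-inv! i≤n) ⟩
      (ι (a i) * ι (b (n ∸ i))) * (inv! i * inv! (n ∸ i))
        ≡⟨ lem₂ (ι (a i)) (ι (b (n ∸ i))) (inv! i) (inv! (n ∸ i)) ⟩
      N a i * N b (n ∸ i) ∎

  N-cong : ∀ {a b} → a ≗ b → N a ≗ N b
  N-cong e n = cong (λ x → ι x * inv! n) (e n)

  N-1 : N (γ 0) ≗ oneS
  N-1 zero    = refl
  N-1 (suc n) = *-zeroˡ (inv! (suc n))

  N-t : N (γ 1) ≗ tS
  N-t zero          = refl
  N-t (suc zero)    = refl
  N-t (suc (suc n)) = *-zeroˡ (inv! (suc (suc n)))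

  powS-N : ∀ a i → powS (N a) i ≗ N (TermwiseDivisibility.powH a i)
  powS-N a zero    n = sym (N-1 n)
  powS-N a (suc i) n = trans (⊛-cong {N a} (λ _ → refl) (powS-N a i) n) (sym (N-⋆ a (TermwiseDivisibility.powH a i) n))

  powS-cong : ∀ {g g′} i → g ≗ g′ → powS g i ≗ powS g′ i
  powS-cong zero    e n = refl
  powS-cong (suc i) e n = ⊛-cong e (powS-cong i e) n

  powS-local : ∀ {g g′} m i → (∀ j → j ≤ m → g j ≡ g′ j) → ∀ j → j ≤ m → powS g i j ≡ powS g′ i j
  powS-local m zero    e j l = refl
  powS-local m (suc i) e j l = ⊛-local j (λ k k≤j → e k (ℕₚ.≤-trans k≤j l))
                                         (λ k k≤j → powS-local m i e k (ℕₚ.≤-trans k≤j l))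

  powS-< : ∀ g → g 0 ≡ 0ℚ → ∀ i n → n < i → powS g i n ≡ 0ℚ
  powS-< g g₀ (suc i) n (s≤s n≤i) = Σ-0 (suc n) term
    where
    term : ∀ j → j < suc n → g j * powS g i (n ∸ j) ≡ 0ℚ
    term zero    _        rewrite g₀ = *-zeroˡ (powS g i n)
    term (suc j) (s≤s j<n) = trans (cong (g (suc j) *_) (powS-< g g₀ i (n ∸ suc j)
        (ℕₚ.<-≤-trans (ℕₚ.∸-monoʳ-< (s≤s z≤n) j<n) n≤i))) (*-zeroʳ (g (suc j)))

  powS-1 : ∀ g n → powS g 1 n ≡ g n
  powS-1 g n = trans (cong₂ _+_ (Σ-0 n zeros) last) (+-identityˡ (g n))
    where
    oneS-> : ∀ m → 0 < m → oneS m ≡ 0ℚ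
    oneS-> (suc m) _ = refl
    zeros : ∀ j → j < n → g j * oneS (n ∸ j) ≡ 0ℚ
    zeros j j<n = trans (cong (g j *_) (oneS-> (n ∸ j) (ℕₚ.m<n⇒0<n∸m j<n))) (*-zeroʳ (g j))
    last : g n * oneS (n ∸ n) ≡ g n
    last rewrite ℕₚ.n∸n≡0 n = *-identityʳ (g n)

  -- For i ≥ 2 the n-th coefficient of gⁱ only involves g₁, …, gₙ₋₁.
  powS-local-suc : ∀ {g g′} → g 0 ≡ 0ℚ → g′ 0 ≡ 0ℚ → ∀ m i → (∀ j → j ≤ m → g j ≡ g′ j) →
                   powS g (suc (suc i)) (suc m) ≡ powS g′ (suc (suc i)) (suc m)
  powS-local-suc {g} {g′} g₀ g′₀ m i e = Σ-cong (suc (suc m)) term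
    where
    term : ∀ j → j < suc (suc m) → g j * powS g (suc i) (suc m ∸ j) ≡ g′ j * powS g′ (suc i) (suc m ∸ j)
    term zero    _ rewrite g₀ | g′₀ = trans (*-zeroˡ (powS g (suc i) (suc m))) (sym (*-zeroˡ (powS g′ (suc i) (suc m))))
    term (suc j) (s≤s (s≤s j≤m)) with j ℕ.≟ m
    ... | yes refl = trans (vanish g g₀) (sym (vanish g′ g′₀))
      where
      vanish : ∀ g → g 0 ≡ 0ℚ → g (suc j) * powS g (suc i) (j ∸ j) ≡ 0ℚ
      vanish g g₀ = trans (cong (g (suc j) *_) (powS-< g g₀ (suc i) (j ∸ j) (subst (_< suc i) (sym (ℕₚ.n∸n≡0 j)) (s≤s z≤n))))
                            (*-zeroʳ (g (suc j)))
    ... | no  j≢m  = cong₂ _*_ (e (suc j) (ℕₚ.≤∧≢⇒< j≤m j≢m)) (powS-local m (suc i) e (m ∸ j) (ℕₚ.m∸n≤m m j))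

  -- The new coefficient g (m + 1) is isolated with factor F 1 = 1; when g 0 = 0, the remaining sum
  -- involves only earlier coefficients. The summand `F 0 * 0ℚ` belongs to g⁰ = 1, which has nothing
  -- in positive degree.
  compS-split : ∀ F g m → F 1 ≡ 1ℚ →
    compS F g (suc m) ≡ F 0 * 0ℚ + (g (suc m) + Σ< m (λ i → F (suc (suc i)) * powS g (suc (suc i)) (suc m)))
  compS-split F g m F₁ = trans (Σ-head (suc m) _) (cong (λ z → F 0 * 0ℚ + z) (trans (Σ-head m _)
    (cong (_+ Σ< m (λ i → F (suc (suc i)) * powS g (suc (suc i)) (suc m)))
      (trans (cong (_* powS g 1 (suc m)) F₁) (trans (*-identityˡ _) (powS-1 g (suc m)))))))

  compInverse-unique : ∀ {F g g′} → F 1 ≡ 1ℚ → IsCompInverse F g → IsCompInverse F g′ → g ≗ g′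
  compInverse-unique {F} {g} {g′} F₁ (g₀ , e) (g′₀ , e′) n = agree n n ℕₚ.≤-refl
    where
    cancel : ∀ x y z w → x + (y + z) ≡ x + (w + z) → y ≡ w
    cancel x y z w eq = +-cancelʳ z y w (+-cancelˡ x (y + z) (w + z) eq)
    agree : ∀ n j → j ≤ n → g j ≡ g′ j
    agree n       zero    _       = trans g₀ (sym g′₀)
    agree (suc n) (suc m) (s≤s l) = cancel (F 0 * 0ℚ) (g (suc m)) (R g) (g′ (suc m)) (begin
      F 0 * 0ℚ + (g (suc m) + R g)    ≡⟨ compS-split F g m F₁ ⟨
      compS F g (suc m)               ≡⟨ trans (e (suc m)) (sym (e′ (suc m))) ⟩
      compS F g′ (suc m)              ≡⟨ compS-split F g′ m F₁ ⟩
      F 0 * 0ℚ + (g′ (suc m) + R g′)  ≡⟨ cong (λ z → F 0 * 0ℚ + (g′ (suc m) + z)) (Σ-cong m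
            (λ i _ → cong (F (suc (suc i)) *_) (powS-local-suc g₀ g′₀ m i (λ j j≤m → agree n j (ℕₚ.≤-trans j≤m l))))) ⟨
      F 0 * 0ℚ + (g′ (suc m) + R g)   ∎)
      where
      open ≡-Reasoning
      R : Series → ℚ
      R g = Σ< m (λ i → F (suc (suc i)) * powS g (suc (suc i)) (suc m))

  -- Degree j determines T j from the earlier coefficients up to the factor u 0, and degree 0 of the
  -- equation shows that u 0 is invertible.
  ⊛-inverse-unique : ∀ {u T T′} → (∀ n → (T ⊛ u) n ≡ oneS n) → (∀ n → (T′ ⊛ u) n ≡ oneS n) → T ≗ T′
  ⊛-inverse-unique {u} {T} {T′} e e′ n = agree (suc n) n ℕₚ.≤-refl
    where
    open ≡-Reasoning
    T₀u₀ : T 0 * u 0 ≡ 1ℚ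
    T₀u₀ = trans (sym (+-identityˡ (T 0 * u 0))) (e 0)
    cancel : ∀ x y → x * u 0 ≡ y * u 0 → x ≡ y
    cancel x y eq = begin
      x                  ≡⟨ *-identityʳ x ⟨
      x * 1ℚ             ≡⟨ cong (x *_) T₀u₀ ⟨
      x * (T 0 * u 0)    ≡⟨ lem x (T 0) (u 0) ⟩
      T 0 * (x * u 0)    ≡⟨ cong (T 0 *_) eq ⟩
      T 0 * (y * u 0)    ≡⟨ lem y (T 0) (u 0) ⟨
      y * (T 0 * u 0)    ≡⟨ cong (y *_) T₀u₀ ⟩
      y * 1ℚ             ≡⟨ *-identityʳ y ⟩
      y                  ∎
      where
      lem : ∀ x y z → x * (y * z) ≡ y * (x * z)
      lem = solve-∀ ℚ-ring
    agree : ∀ n j → j < n → T j ≡ T′ j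
    agree (suc n) j (s≤s j≤n) = cancel (T j) (T′ j) (+-cancelˡ (R T) _ _ (begin
      R T + T j * u 0            ≡⟨ cong (λ m → R T + T j * u m) (ℕₚ.n∸n≡0 j) ⟨
      (T ⊛ u) j                  ≡⟨ trans (e j) (sym (e′ j)) ⟩
      (T′ ⊛ u) j                 ≡⟨ cong₂ (λ x m → x + T′ j * u m)
                                     (Σ-cong j (λ i i<j → cong (_* u (j ∸ i)) (sym (agree n i (ℕₚ.<-≤-trans i<j j≤n)))))
                                     (ℕₚ.n∸n≡0 j) ⟩
      R T + T′ j * u 0           ∎))
      where
      R : Series → ℚ
      R S = Σ< j (λ i → S i * u (j ∸ i))

-- The expansion of t/G(t) and integrality.

module Integrality where

  open import Defs
  open HurwitzSeries
  open RationalSeries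
  open TermwiseDivisibility using (fac; pw; pw-1; dilate; powH; module Composition)
  open import Data.Nat as ℕ using (ℕ; zero; suc; _≤_; s≤s; _∸_; _!)
  import Data.Nat.Properties as ℕₚ
  open import Data.Nat.Primality using (Prime)
  open import Data.Integer as ℤ using (ℤ; +_; 0ℤ; 1ℤ)
  import Data.Integer.Properties as ℤₚ
  import Data.Integer.Tactic.RingSolver as ℤ-Solver
  open import Data.Integer.Divisibility.Signed using (_∣_; divides)
  open import Data.Rational using (ℚ; 0ℚ; 1ℚ; _+_; _*_; _-_; _/_)
  open import Data.Rational.Properties
  open import Tactic.RingSolver using (solve-∀)
  open import Data.Product using (∃; _,_; proj₁; proj₂)
  open import Data.Sum using (_⊎_)
  open import Relation.Binary.PropositionalEquality

  module _ (c : ℕ → ℤ) (c₀ : c 0 ≡ 1ℤ) where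

    open Composition c c₀

    -- F as a Hurwitz series: (i+1)! · cᵢ/(i+1) = i! cᵢ is integral although cᵢ/(i+1) need not be.
    F̂ : H
    F̂ zero    = 0ℤ
    F̂ (suc i) = f i

    Φ-partialSum : ∀ a M n → Φ q (partialSum a M) n ≡ sumℤ M (λ i → a i ℤ.* A i n)
    Φ-partialSum a zero    n = trans (Φ-cong q (λ m → sym (ℤₚ.*-zeroˡ (γ 0 m))) n)
                                     (trans (Φ-⊙ q 0ℤ (γ 0) n) (ℤₚ.*-zeroˡ (A 0 n)))
    Φ-partialSum a (suc M) n = trans (Φ-⊞ q (partialSum a M) (a M ⊙ γ M) n)
                                     (cong₂ ℤ._+_ (Φ-partialSum a M n) (Φ-⊙ q (a M) (γ M) n))

    -- This is F(G(t)) = t, which holds because q d/ds sends F to q F′ = 1. The sum may stop at n,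
    -- since degree n of the composite sees F only up to degree n.
    Φ-F̂ : ∀ n → sumℤ (suc n) (λ i → F̂ i ℤ.* A i n) ≡ γ 1 n
    Φ-F̂ n = trans (sym (Φ-partialSum F̂ (suc n) n))
                  (trans (Φ-local q n (λ j l → partialSum-< F̂ (suc n) (s≤s l))) (inverse n))
      where
      inverse : Φ q F̂ ≗ γ 1
      inverse zero    = refl
      inverse (suc n) = trans (Φ-cong q (λ m → trans (⋆-comm q f m) (f⋆q m)) n) (Φ-1 q n)

    ĝ : Series
    ĝ = N (A 1)

    FS-fac : ∀ i → FS c i * ι (fac i) ≡ ι (F̂ i)
    FS-fac zero    = *-zeroˡ (ι (fac 0))
    FS-fac (suc i) = begin
      (c i / suc i) * ι (+ (suc i !))                  ≡⟨ cong (λ x → (c i / suc i) * x) (trans (cong ι (ℤₚ.pos-* (suc i) (i !))) (ι-* (+ suc i) (fac i))) ⟩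
      (c i / suc i) * (ι (+ suc i) * ι (fac i))        ≡⟨ *-assoc (c i / suc i) (ι (+ suc i)) (ι (fac i)) ⟨
      (c i / suc i) * ι (+ suc i) * ι (fac i)          ≡⟨ cong (_* ι (fac i)) (/-cancel (c i) (suc i)) ⟩
      ι (c i) * ι (fac i)                              ≡⟨ ι-* (c i) (fac i) ⟨
      ι (c i ℤ.* fac i)                                ∎
      where open ≡-Reasoning

    ĝ-compInverse : IsCompInverse (FS c) ĝ
    ĝ-compInverse = refl , λ n → begin
      Σ< (suc n) (λ i → FS c i * powS ĝ i n)                 ≡⟨ Σ-cong (suc n) (λ i _ → term n i) ⟩
      Σ< (suc n) (λ i → ι (F̂ i ℤ.* A i n) * inv! n)          ≡⟨ Σ-*ʳ (suc n) (inv! n) _ ⟨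
      Σ< (suc n) (λ i → ι (F̂ i ℤ.* A i n)) * inv! n          ≡⟨ cong (_* inv! n) (ι-sumℤ (suc n) _) ⟨
      ι (sumℤ (suc n) (λ i → F̂ i ℤ.* A i n)) * inv! n        ≡⟨ cong (λ x → ι x * inv! n) (Φ-F̂ n) ⟩
      N (γ 1) n                                              ≡⟨ N-t n ⟩
      tS n                                                   ∎
      where
      open ≡-Reasoning
      lem : ∀ x y z w → x * ((y * z) * w) ≡ ((x * y) * z) * w
      lem = solve-∀ ℚ-ring
      term : ∀ n i → FS c i * powS ĝ i n ≡ ι (F̂ i ℤ.* A i n) * inv! n
      term n i = begin
        FS c i * powS ĝ i n                          ≡⟨ cong (FS c i *_) (trans (powS-N (A 1) i n) (N-cong (powA i) n)) ⟩
        FS c i * (ι (fac i ℤ.* A i n) * inv! n)      ≡⟨ cong (λ x → FS c i * (x * inv! n)) (ι-* (fac i) (A i n)) ⟩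
        FS c i * ((ι (fac i) * ι (A i n)) * inv! n)  ≡⟨ lem (FS c i) (ι (fac i)) (ι (A i n)) (inv! n) ⟩
        ((FS c i * ι (fac i)) * ι (A i n)) * inv! n  ≡⟨ cong (λ x → (x * ι (A i n)) * inv! n) (FS-fac i) ⟩
        (ι (F̂ i) * ι (A i n)) * inv! n               ≡⟨ cong (_* inv! n) (ι-* (F̂ i) (A i n)) ⟨
        ι (F̂ i ℤ.* A i n) * inv! n                   ∎

    module _ (g : Series) (g-inv : IsCompInverse (FS c) g) where

      g≗ĝ : g ≗ ĝ
      g≗ĝ = compInverse-unique {FS c} (cong ι c₀) g-inv ĝ-compInverse

      g₀ : g 0 ≡ 0ℚ
      g₀ = g≗ĝ 0

      powS-g : ∀ i → powS g i ≗ N (powH (A 1) i)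
      powS-g i n = trans (powS-cong i g≗ĝ n) (powS-N (A 1) i n)

      -- Commutativity is borrowed from `⋆` through `N`.
      powS-⊛-comm : ∀ i → powS g i ⊛ g ≗ powS g (suc i)
      powS-⊛-comm i n = begin
        (powS g i ⊛ g) n                 ≡⟨ ⊛-cong (powS-g i) g≗ĝ n ⟩
        (N (powH (A 1) i) ⊛ N (A 1)) n   ≡⟨ N-⋆ (powH (A 1) i) (A 1) n ⟨
        N (powH (A 1) i ⋆ A 1) n         ≡⟨ N-cong (⋆-comm (powH (A 1) i) (A 1)) n ⟩
        N (powH (A 1) (suc i)) n         ≡⟨ powS-g (suc i) n ⟨
        powS g (suc i) n                 ∎
        where open ≡-Reasoning

      powS-⊛-divT : ∀ i n → (powS g i ⊛ divT g) n ≡ powS g (suc i) (suc n)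
      powS-⊛-divT i n = sym (begin
        powS g (suc i) (suc n)           ≡⟨ powS-⊛-comm i (suc n) ⟨
        Σ< (suc n) (λ j → powS g i j * g (suc n ∸ j)) + powS g i (suc n) * g (n ∸ n)
          ≡⟨ cong₂ _+_ (Σ-cong (suc n) (λ { j (s≤s j≤n) → cong (λ m → powS g i j * g m) (ℕₚ.+-∸-assoc 1 j≤n) }))
                       (trans (cong (λ m → powS g i (suc n) * g m) (ℕₚ.n∸n≡0 n))
                              (trans (cong (powS g i (suc n) *_) g₀) (*-zeroʳ (powS g i (suc n))))) ⟩
        (powS g i ⊛ divT g) n + 0ℚ       ≡⟨ +-identityʳ _ ⟩
        (powS g i ⊛ divT g) n            ∎)
        where open ≡-Reasoning

      -- t/G(t) is F(s)/s evaluated at s = G(t).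
      Θ : Series
      Θ = compS (divT (FS c)) g

      -- A range independent of j allows double sums to be exchanged; the added terms vanish because
      -- gⁱ has order at least i.
      Θ-extend : ∀ {n j} → j ≤ n → Θ j ≡ Σ< (suc n) (λ i → FS c (suc i) * powS g i j)
      Θ-extend {n} {j} j≤n = sym (Σ-extend (suc j) (s≤s j≤n)
        (λ i j<i → trans (cong (FS c (suc i) *_) (powS-< g g₀ i j j<i)) (*-zeroʳ (FS c (suc i)))))

      Θ-⊛ : ∀ u n → (Θ ⊛ u) n ≡ Σ< (suc n) (λ i → FS c (suc i) * (powS g i ⊛ u) n)
      Θ-⊛ u n = begin
        Σ< (suc n) (λ j → Θ j * u (n ∸ j))
          ≡⟨ Σ-cong (suc n) (λ { j (s≤s j≤n) → trans (cong (_* u (n ∸ j)) (Θ-extend j≤n)) (Σ-*ʳ (suc n) (u (n ∸ j)) _) }) ⟩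
        Σ< (suc n) (λ j → Σ< (suc n) (λ i → FS c (suc i) * powS g i j * u (n ∸ j)))
          ≡⟨ Σ-swap (suc n) (suc n) (λ j i → FS c (suc i) * powS g i j * u (n ∸ j)) ⟩
        Σ< (suc n) (λ i → Σ< (suc n) (λ j → FS c (suc i) * powS g i j * u (n ∸ j)))
          ≡⟨ Σ-cong (suc n) (λ i _ → trans (Σ-cong (suc n) (λ j _ → *-assoc (FS c (suc i)) (powS g i j) (u (n ∸ j))))
                                           (sym (Σ-*ˡ (suc n) (FS c (suc i)) _))) ⟩
        Σ< (suc n) (λ i → FS c (suc i) * (powS g i ⊛ u) n) ∎
        where open ≡-Reasoning

      -- Multiplying F(s)/s at s = G by G/t gives F(G(t))/t = 1.
      Θ-isTOverG : IsTOverG g Θ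
      Θ-isTOverG n = begin
        (Θ ⊛ divT g) n                                                ≡⟨ Θ-⊛ (divT g) n ⟩
        Σ< (suc n) (λ i → FS c (suc i) * (powS g i ⊛ divT g) n)       ≡⟨ Σ-cong (suc n) (λ i _ → cong (FS c (suc i) *_) (powS-⊛-divT i n)) ⟩
        Σ< (suc n) (λ i → FS c (suc i) * powS g (suc i) (suc n))      ≡⟨ +-identityˡ _ ⟨
        0ℚ * 0ℚ + Σ< (suc n) (λ i → FS c (suc i) * powS g (suc i) (suc n)) ≡⟨ Σ-head (suc n) (λ i → FS c i * powS g i (suc n)) ⟨
        compS (FS c) g (suc n)                                        ≡⟨ proj₂ g-inv (suc n) ⟩
        tS (suc n)                                                    ≡⟨ tS-suc n ⟩
        oneS n                                                        ∎
        where
        open ≡-Reasoning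
        tS-suc : ∀ n → tS (suc n) ≡ oneS n
        tS-suc zero    = refl
        tS-suc (suc n) = refl

      module _ (T : Series) (T-inv : IsTOverG g T)
               (c-prime : ∀ p → Prime (suc p) → (+ suc p ∣ c p) ⊎ (+ suc p ∣ c p ℤ.- 1ℤ))
               (c-four : (+ 2 ∣ c 3) ⊎ (+ 2 ∣ c 1 ℤ.- 1ℤ)) where

        T≗Θ : T ≗ Θ
        T≗Θ = ⊛-inverse-unique {divT g} T-inv Θ-isTOverG

        integral-term : ∀ i h k n → ∃ λ z → FS c (suc i) * ι ((dilate (+ k) (powH (A 1) i) ⋆ pw-1 (+ h)) n) ≡ ι z
        integral-term i h k n with suc∣term c-prime c-four i h k n
        ... | divides z eq = z , (begin
          x * ι X                                    ≡⟨ *-identityʳ (x * ι X) ⟨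
          x * ι X * 1ℚ                               ≡⟨ cong (x * ι X *_) (/-cancel 1ℤ (suc i)) ⟨
          x * ι X * (r * d)                          ≡⟨ lem₁ x (ι X) r d ⟩
          x * d * ι X * r                            ≡⟨ cong (λ y → y * ι X * r) (/-cancel (c i) (suc i)) ⟩
          ι (c i) * ι X * r                          ≡⟨ cong (_* r) (ι-* (c i) X) ⟨
          ι (c i ℤ.* X) * r                          ≡⟨ cong (λ y → ι y * r) (trans (cong (λ y → c i ℤ.* y) X≡) eq) ⟩
          ι (z ℤ.* + suc i) * r                      ≡⟨ cong (_* r) (ι-* z (+ suc i)) ⟩
          ι z * d * r                                ≡⟨ lem₂ (ι z) d r ⟩
          ι z * (r * d)                              ≡⟨ cong (ι z *_) (/-cancel 1ℤ (suc i)) ⟩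
          ι z * 1ℚ                                   ≡⟨ *-identityʳ (ι z) ⟩
          ι z                                        ∎)
          where
          open ≡-Reasoning
          x d r : ℚ
          x = c i / suc i
          d = ι (+ suc i)
          r = 1ℤ / suc i
          X : ℤ
          X = (dilate (+ k) (powH (A 1) i) ⋆ pw-1 (+ h)) n
          lem₁ : ∀ x y r d → x * y * (r * d) ≡ x * d * y * r
          lem₁ = solve-∀ ℚ-ring
          lem₂ : ∀ x y z → x * y * z ≡ x * (z * y)
          lem₂ = solve-∀ ℚ-ring
          swap : ∀ x y z → x ℤ.* (y ℤ.* z) ≡ y ℤ.* (x ℤ.* z)
          swap = ℤ-Solver.solve-∀
          X≡ : X ≡ fac i ℤ.* (dilate (+ k) (A i) ⋆ pw-1 (+ h)) n
          X≡ = trans (⋆-congʳ (pw-1 (+ h)) (λ j → trans (cong ((+ k) ℤ.^ j ℤ.*_) (powA i j))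
                                                         (swap ((+ k) ℤ.^ j) (fac i) (A i j))) n)
                     (⋆-scaleʳ (fac i) (dilate (+ k) (A i)) (pw-1 (+ h)) n)

        ^-split : ∀ x {n j} → j ≤ n → x ^ℚ n ≡ (x ^ℚ j) * (x ^ℚ (n ∸ j))
        ^-split x {n}     {zero}  _       = sym (*-identityˡ (x ^ℚ n))
        ^-split x {suc n} {suc j} (s≤s l) = trans (cong (x *_) (^-split x l)) (sym (*-assoc x (x ^ℚ j) (x ^ℚ (n ∸ j))))

        scale-exp : ∀ κ y z → κ * y ≡ ι z → ∀ m → (κ ^ℚ m) * expS y m ≡ N (pw z) m
        scale-exp κ y z e m = trans (sym (*-assoc (κ ^ℚ m) (y ^ℚ m) (inv! m))) (cong (_* inv! m) (power m))
          where
          lem : ∀ a b c d → (a * b) * (c * d) ≡ (a * c) * (b * d)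
          lem = solve-∀ ℚ-ring
          power : ∀ m → (κ ^ℚ m) * (y ^ℚ m) ≡ ι (z ℤ.^ m)
          power zero    = refl
          power (suc m) = trans (lem κ (κ ^ℚ m) y (y ^ℚ m)) (trans (cong₂ _*_ e (power m)) (sym (ι-* z (z ℤ.^ m))))

        -- The factor κⁿ amounts to substituting κt for t, which makes the exponent κy the integer
        -- z.
        scale-⊛ : ∀ κ y z → κ * y ≡ ι z → ∀ n →
                  (κ ^ℚ n) * (T ⊛ expS y) n ≡ ((λ j → (κ ^ℚ j) * T j) ⊛ N (pw z)) n
        scale-⊛ κ y z e n = trans (Σ-*ˡ (suc n) (κ ^ℚ n) _) (Σ-cong (suc n) (λ { j (s≤s j≤n) →
          trans (cong (_* (T j * expS y (n ∸ j))) (^-split κ j≤n))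
          (trans (lem (κ ^ℚ j) (κ ^ℚ (n ∸ j)) (T j) (expS y (n ∸ j)))
                 (cong (λ x → ((κ ^ℚ j) * T j) * x) (scale-exp κ y z e (n ∸ j)))) }))
          where
          lem : ∀ a b c d → (a * b) * (c * d) ≡ (a * c) * (b * d)
          lem = solve-∀ ℚ-ring

        N-pw-1 : ∀ z → (λ j → N (pw z) j - N (pw 0ℤ) j) ≗ N (pw-1 z)
        N-pw-1 z j = begin
          ι (pw z j) * inv! j - ι (pw 0ℤ j) * inv! j   ≡⟨ lem (ι (pw z j)) (ι (pw 0ℤ j)) (inv! j) ⟩
          (ι (pw z j) - ι (pw 0ℤ j)) * inv! j          ≡⟨ cong (_* inv! j) (ι-minus (pw z j) (pw 0ℤ j)) ⟨
          ι (pw z j ℤ.- pw 0ℤ j) * inv! j              ≡⟨ cong (λ x → ι (pw z j ℤ.- x) * inv! j) (pw-0 j) ⟩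
          N (pw-1 z) j                                 ∎
          where
          open ≡-Reasoning
          lem : ∀ a b d → a * d - b * d ≡ (a - b) * d
          lem = solve-∀ ℚ-ring
          pw-0 : pw 0ℤ ≗ γ 0
          pw-0 zero    = refl
          pw-0 (suc j) = ℤₚ.*-zeroˡ (0ℤ ℤ.^ j)

        dilate-⊛ : ∀ k u n → ((λ j → (ι (+ k) ^ℚ j) * T j) ⊛ N u) n
                           ≡ Σ< (suc n) (λ i → FS c (suc i) * N (dilate (+ k) (powH (A 1) i) ⋆ u) n)
        dilate-⊛ k u n = begin
          Σ< (suc n) (λ j → ((ι (+ k) ^ℚ j) * T j) * N u (n ∸ j))
            ≡⟨ Σ-cong (suc n) (λ { j (s≤s j≤n) → cong (_* N u (n ∸ j)) (expand j≤n) }) ⟩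
          Σ< (suc n) (λ j → Σ< (suc n) (λ i → x i * N (P i) j) * N u (n ∸ j))
            ≡⟨ Σ-cong (suc n) (λ j _ → Σ-*ʳ (suc n) (N u (n ∸ j)) (λ i → x i * N (P i) j)) ⟩
          Σ< (suc n) (λ j → Σ< (suc n) (λ i → x i * N (P i) j * N u (n ∸ j)))
            ≡⟨ Σ-swap (suc n) (suc n) (λ j i → x i * N (P i) j * N u (n ∸ j)) ⟩
          Σ< (suc n) (λ i → Σ< (suc n) (λ j → x i * N (P i) j * N u (n ∸ j)))
            ≡⟨ Σ-cong (suc n) (λ i _ → trans (Σ-cong (suc n) (λ j _ → *-assoc (x i) (N (P i) j) (N u (n ∸ j))))
                 (trans (sym (Σ-*ˡ (suc n) (x i) _)) (cong (x i *_) (sym (N-⋆ (P i) u n))))) ⟩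
          Σ< (suc n) (λ i → x i * N (P i ⋆ u) n) ∎
          where
          open ≡-Reasoning
          x : ℕ → ℚ
          x i = FS c (suc i)
          P : ℕ → H
          P i = dilate (+ k) (powH (A 1) i)
          lem : ∀ a b d e → a * (b * (d * e)) ≡ b * ((a * d) * e)
          lem = solve-∀ ℚ-ring
          expand : ∀ {j} → j ≤ n → (ι (+ k) ^ℚ j) * T j ≡ Σ< (suc n) (λ i → x i * N (P i) j)
          expand {j} j≤n = begin
            (ι (+ k) ^ℚ j) * T j
              ≡⟨ cong ((ι (+ k) ^ℚ j) *_) (trans (T≗Θ j) (Θ-extend j≤n)) ⟩
            (ι (+ k) ^ℚ j) * Σ< (suc n) (λ i → x i * powS g i j)
              ≡⟨ Σ-*ˡ (suc n) (ι (+ k) ^ℚ j) _ ⟩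
            Σ< (suc n) (λ i → (ι (+ k) ^ℚ j) * (x i * powS g i j))
              ≡⟨ Σ-cong (suc n) (λ i _ → trans (cong (λ y → (ι (+ k) ^ℚ j) * (x i * y)) (powS-g i j))
                   (trans (lem (ι (+ k) ^ℚ j) (x i) (ι (powH (A 1) i j)) (inv! j))
                     (cong (λ y → x i * (y * inv! j)) (trans (cong (_* ι (powH (A 1) i j)) (sym (ι-^ (+ k) j)))
                       (sym (ι-* ((+ k) ℤ.^ j) (powH (A 1) i j))))))) ⟩
            Σ< (suc n) (λ i → x i * N (P i) j) ∎

        BGt-expand : ∀ h k n → (ι (+ suc k) ^ℚ n) * BGt T n ((+ suc h) / suc k) ≡
          Σ< (suc n) (λ i → FS c (suc i) * ι ((dilate (+ suc k) (powH (A 1) i) ⋆ pw-1 (+ suc h)) n))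
        BGt-expand h k n = begin
          κn * (n! * (T ⊛ expS y) n - n! * (T ⊛ expS 0ℚ) n)
            ≡⟨ lem₁ κn n! ((T ⊛ expS y) n) ((T ⊛ expS 0ℚ) n) ⟩
          n! * (κn * (T ⊛ expS y) n - κn * (T ⊛ expS 0ℚ) n)
            ≡⟨ cong₂ (λ a b → n! * (a - b))
                 (scale-⊛ κ y (+ suc h) (trans (*-comm κ y) (/-cancel (+ suc h) (suc k))) n)
                 (scale-⊛ κ 0ℚ 0ℤ (*-zeroʳ κ) n) ⟩
          n! * ((T′ ⊛ N (pw (+ suc h))) n - (T′ ⊛ N (pw 0ℤ)) n)
            ≡⟨ cong (n! *_) (trans (⊛-minusʳ T′ (N (pw (+ suc h))) (N (pw 0ℤ)) n) (⊛-cong {T′} (λ _ → refl) (N-pw-1 (+ suc h)) n)) ⟩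
          n! * (T′ ⊛ N (pw-1 (+ suc h))) n
            ≡⟨ cong (n! *_) (dilate-⊛ (suc k) (pw-1 (+ suc h)) n) ⟩
          n! * Σ< (suc n) (λ i → FS c (suc i) * (ι (X i) * inv! n))
            ≡⟨ Σ-*ˡ (suc n) n! _ ⟩
          Σ< (suc n) (λ i → n! * (FS c (suc i) * (ι (X i) * inv! n)))
            ≡⟨ Σ-cong (suc n) (λ i _ → trans (lem₂ n! (FS c (suc i)) (ι (X i)) (inv! n))
                 (trans (cong (FS c (suc i) * ι (X i) *_) (inv!-cancel n)) (*-identityʳ _))) ⟩
          Σ< (suc n) (λ i → FS c (suc i) * ι (X i)) ∎
          where
          open ≡-Reasoning
          κ κn n! y : ℚ
          κ  = ι (+ suc k)
          κn = κ ^ℚ n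
          n! = ι (+ (n !))
          y  = (+ suc h) / suc k
          T′ : Series
          T′ j = (κ ^ℚ j) * T j
          X : ℕ → ℤ
          X i = (dilate (+ suc k) (powH (A 1) i) ⋆ pw-1 (+ suc h)) n
          lem₁ : ∀ a b c d → a * (b * c - b * d) ≡ b * (a * c - a * d)
          lem₁ = solve-∀ ℚ-ring
          lem₂ : ∀ a b c d → a * (b * (c * d)) ≡ b * c * (d * a)
          lem₂ = solve-∀ ℚ-ring

        integrality : ∀ h k n → ∃ λ z → (ι (+ suc k) ^ℚ n) * BGt T n ((+ suc h) / suc k) ≡ ι z
        integrality h k n = proj₁ sum , trans (BGt-expand h k n) (proj₂ sum)
          where sum = Σ-integral (suc n) (λ i → integral-term i (suc h) (suc k) n)

-- Translation of the congruence hypotheses.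

open import Defs
open import Data.Nat using (ℕ; suc; _∸_; s≤s)
import Data.Nat as ℕ
open import Data.Nat.Primality using (Prime)
open import Data.Integer using (ℤ; +_; _-_)
import Data.Integer as ℤ
import Data.Integer.Properties as ℤₚ
open import Data.Integer.DivMod using (_%ℕ_; _/ℕ_; a≡a%ℕn+[a/ℕn]*n; n%ℕd<d)
open import Data.Integer.Divisibility using (_∣_)
import Data.Integer.Divisibility.Signed as Signed
import Data.Integer.Tactic.RingSolver as ℤ-Solver
open import Data.Rational using (_*_; _/_)
open import Data.Product using (_×_; ∃; _,_)
open import Data.Sum using (_⊎_; inj₁; inj₂)
import Data.Sum as Sum
open import Relation.Nullary using (¬_; yes; no)
open import Relation.Binary.PropositionalEquality using (_≡_; _≢_; refl; trans; cong; subst)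

-- Supplies the alternative for c_{p-1} at p = 2, so that all primes are treated alike.
parity : ∀ x → (+ 2 Signed.∣ x) ⊎ (+ 2 Signed.∣ x - + 1)
parity x with x %ℕ 2 | a≡a%ℕn+[a/ℕn]*n x 2 | n%ℕd<d x 2
... | 0           | eq | _ = inj₁ (Signed.divides (x /ℕ 2) (trans eq (ℤₚ.+-identityˡ _)))
... | 1           | eq | _ = inj₂ (Signed.divides (x /ℕ 2) (trans (cong (_- + 1) eq) (lem (x /ℕ 2 ℤ.* + 2))))
  where
  lem : ∀ y → + 1 ℤ.+ y - + 1 ≡ y
  lem = ℤ-Solver.solve-∀
... | suc (suc _) | _  | s≤s (s≤s ())

theorem1 : (c : ℕ → ℤ) → c 0 ≡ + 1
    → (∀ p → Prime p → p ≢ 2 → (+ p ∣ c (p ∸ 1)) ⊎ (+ p ∣ (c (p ∸ 1) - + 1)))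
    → ((+ 2 ∣ (c 1 - c 3)) ⊎ ((¬ (+ 2 ∣ c 1)) × (+ 2 ∣ c 3)))
    → (g : Series) → IsCompInverse (FS c) g
    → (T : Series) → IsTOverG g T
    → (h k n : ℕ)
    → ∃ (λ (z : ℤ) → (ι (+ (suc k)) ^ℚ n) * BGt T n ((+ (suc h)) / (suc k)) ≡ ι z)
theorem1 c c₀ c-odd c-even g g-inv T T-inv = Integrality.integrality c c₀ g g-inv T T-inv c-prime (c-four c-even)
  where
  c-prime : ∀ p → Prime (suc p) → (+ suc p Signed.∣ c p) ⊎ (+ suc p Signed.∣ c p - + 1)
  c-prime p pr with suc p ℕ.≟ 2
  ... | yes refl = parity (c 1)
  ... | no  p≢2  = Sum.map Signed.∣ᵤ⇒∣ Signed.∣ᵤ⇒∣ (c-odd (suc p) pr p≢2)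
  -- Both sides exclude exactly the case of c₁ even and c₃ odd.
  c-four : ((+ 2 ∣ (c 1 - c 3)) ⊎ ((¬ (+ 2 ∣ c 1)) × (+ 2 ∣ c 3))) → (+ 2 Signed.∣ c 3) ⊎ (+ 2 Signed.∣ c 1 - + 1)
  c-four (inj₂ (_ , 2∣c₃)) = inj₁ (Signed.∣ᵤ⇒∣ 2∣c₃)
  c-four (inj₁ 2∣c₁-c₃) with parity (c 1)
  ... | inj₂ 2∣c₁-1 = inj₂ 2∣c₁-1
  ... | inj₁ 2∣c₁   = inj₁ (subst (+ 2 Signed.∣_) (lem (c 1) (c 3))
                        (Signed.∣m∣n⇒∣m-n 2∣c₁ (Signed.∣ᵤ⇒∣ {+ 2} {c 1 - c 3} 2∣c₁-c₃)))
    where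
    lem : ∀ x y → x - (x - y) ≡ y
    lem = ℤ-Solver.solve-∀
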